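{- Let $\mathbb{k}$ be a commutative ring, $n\ge0$, and $\alpha$ a composition of $n$. Then in $\mathbb{k}S_n$, \[ \prod_{k\in\widetilde{n}_\alpha(\Sigma_n)}(w_0B_\alpha-k)=0\qquad\text{and}\qquad\prod_{k\in\widetilde{n}_\alpha(\Sigma_n)}(B_\alpha w_0-k)=0, \] where each product ranges over the distinct elements $k$ of the set $\widetilde{n}_\alpha(\Sigma_n)$ (integers being viewed as elements of $\mathbb{k}S_n$ via $k\mapsto k\cdot 1$).
   Context: $[n]=\{1,\ldots,n\}$; $S_n$ the symmetric group with $(\sigma\tau)(i)=\sigma(\tau(i))$, $\mathbb{k}S_n$ its group algebra, $w_0(i)=n+1-i$. For a composition $\alpha=(\alpha_1,\ldots,\alpha_k)$ of $n$ (positive integers with sum $n$) let $D(\alpha)=\{\alpha_1,\alpha_1+\alpha_2,\ldots,\alpha_1+\cdots+\alpha_{k-1}\}$ and $B_\alpha=\sum_{w\in S_n:\operatorname{Des}w\subseteq D(\alpha)}w$, where $\operatorname{Des}w=\{i\in[n-1]:w(i)>w(i+1)\}$. A set composition of $[n]$ is a tuple $F=(F_1,\ldots,F_m)$ of nonempty pairwise disjoint sets with union $[n]$; $\ell(F)=m$, $\operatorname{type}F=(|F_1|,\ldots,|F_m|)$; $\Sigma_n$ is the set of all of them. $F\preceq G$ means each block of $F$ lies in some block of $G$. $n_\alpha(F)=\#\{G\in\Sigma_n:F\preceq G,\ \operatorname{type}G=\alpha\}$, $\widetilde{n}_\alpha(F)=(-1)^{n-\ell(F)}n_\alpha(F)$,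 $\widetilde{n}_\alpha(\Sigma_n)=\{\widetilde{n}_\alpha(F):F\in\Sigma_n\}$. -}

module Defs where

open import Level using (Level)
open import Algebra.Bundles using (CommutativeRing)
open import Data.Bool using (Bool; true; false; _∧_; if_then_else_; not)
open import Data.Nat as ℕ using (ℕ; zero; suc; _∸_; _<ᵇ_)
open import Data.Integer as ℤ using (ℤ; +_; -[1+_])
open import Data.Fin as Fin using (Fin; toℕ; opposite)
open import Data.Vec as Vec using (Vec; []; _∷_; lookup; tabulate; toList)
import Data.Vec.Properties as VecP
open import Data.List.Base as List using (List; []; _∷_; map; concatMap; filter; length; allFin; upTo; deduplicate; foldr)
open import Data.Bool.ListAction using (all; any)
import Data.List.Properties as ListP
open import Data.Product using (Σ; _,_; proj₁; proj₂)
open import Relation.Nullary using (does)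
open import Function using (_∘_)

allVecs : (m n : ℕ) → List (Vec (Fin m) n)
allVecs m zero    = [] ∷ []
allVecs m (suc n) = concatMap (λ x → map (x ∷_) (allVecs m n)) (allFin m)

_==F_ : ∀ {m} → Fin m → Fin m → Bool
i ==F j = does (i Fin.≟ j)

_==V_ : ∀ {m n} → Vec (Fin m) n → Vec (Fin m) n → Bool
u ==V v = does (VecP.≡-dec Fin._≟_ u v)

_==L_ : List ℕ → List ℕ → Bool
a ==L b = does (ListP.≡-dec ℕ._≟_ a b)

_⇒ᵇ_ : Bool → Bool → Bool
a ⇒ᵇ b = not a Data.Bool.∨ b

isInjective : ∀ {m n} → Vec (Fin m) n → Bool
isInjective {n = n} v =
  all (λ i → all (λ j → (lookup v i ==F lookup v j) ⇒ᵇ (i ==F j)) (allFin n)) (allFin n)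

isSurjective : ∀ {m n} → Vec (Fin m) n → Bool
isSurjective {m} {n} v = all (λ j → any (λ i → lookup v i ==F j) (allFin n)) (allFin m)

-- Permutations of [n]: a permutation w is the vector (w(1),…,w(n))
-- (0-indexed as Fin n).  S_n is enumerated by `perms n`.

isPerm : ∀ {n} → Vec (Fin n) n → Bool
isPerm = isInjective

perms : (n : ℕ) → List (Vec (Fin n) n)
perms n = filter (λ v → Data.Bool.T? (isPerm v)) (allVecs n n)

_∘ₚ_ : ∀ {n} → Vec (Fin n) n → Vec (Fin n) n → Vec (Fin n) n
σ ∘ₚ τ = tabulate (λ i → lookup σ (lookup τ i))

idPerm : (n : ℕ) → Vec (Fin n) n
idPerm n = tabulate (λ i → i)

w₀ : (n : ℕ) → Vec (Fin n) n
w₀ n = tabulate opposite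

-- Descent set (1-indexed positions i ∈ [n-1] with w(i) > w(i+1))
descentsFrom : ℕ → List ℕ → List ℕ
descentsFrom i []           = []
descentsFrom i (x ∷ [])     = []
descentsFrom i (x ∷ y ∷ xs) =
  (if y <ᵇ x then (i ∷_) else (λ l → l)) (descentsFrom (suc i) (y ∷ xs))

Des : ∀ {n} → Vec (Fin n) n → List ℕ
Des w = descentsFrom 1 (map toℕ (toList w))

partialSums : ℕ → List ℕ → List ℕ
partialSums s []            = []
partialSums s (a ∷ [])      = []
partialSums s (a ∷ b ∷ as)  = (s ℕ.+ a) ∷ partialSums (s ℕ.+ a) (b ∷ as)

D : List ℕ → List ℕ
D α = partialSums 0 α

_∈ᵇ_ : ℕ → List ℕ → Bool
x ∈ᵇ l = any (λ y → does (x ℕ.≟ y)) l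

_⊆ᵇ_ : List ℕ → List ℕ → Bool
a ⊆ᵇ b = all (λ x → x ∈ᵇ b) a

-- Set compositions of [n], represented by the surjection f : [n] → [m]
-- sending i to the index of the block containing i (F_j = f⁻¹(j)).

SetComp : ℕ → Set
SetComp n = Σ ℕ (λ m → Vec (Fin m) n)

ℓ : ∀ {n} → SetComp n → ℕ
ℓ = proj₁

setComps : (n : ℕ) → List (SetComp n)
setComps n = concatMap (λ m → map (m ,_) (filter (λ v → Data.Bool.T? (isSurjective v)) (allVecs m n)))
                       (upTo (suc n))

blockSize : ∀ {m n} → Vec (Fin m) n → Fin m → ℕ
blockSize {n = n} f j = length (filter (λ i → Data.Bool.T? (lookup f i ==F j)) (allFin n))

type : ∀ {n} → SetComp n → List ℕ
type (m , f) = map (blockSize f) (allFin m)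

-- F ⪯ G : each block of F lies in some block of G
_⪯ᵇ_ : ∀ {n} → SetComp n → SetComp n → Bool
_⪯ᵇ_ {n} (_ , f) (_ , g) =
  all (λ i → all (λ j → (lookup f i ==F lookup f j) ⇒ᵇ (lookup g i ==F lookup g j)) (allFin n)) (allFin n)

nα : ∀ {n} → List ℕ → SetComp n → ℕ
nα {n} α F = length (filter (λ G → Data.Bool.T? ((F ⪯ᵇ G) ∧ (type G ==L α))) (setComps n))

ñα : ∀ {n} → List ℕ → SetComp n → ℤ
ñα {n} α F = (ℤ.- ℤ.1ℤ) ℤ.^ (n ∸ ℓ F) ℤ.* (+ nα α F)

ñαValues : (n : ℕ) → List ℕ → List ℤ
ñαValues n α = deduplicate ℤ._≟_ (map (ñα α) (setComps n))

-- The group algebra 𝕜 S_n over a commutative ring 𝕜.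
-- An element is a coefficient function on Vec (Fin n) n; all elements
-- built below vanish off S_n, and multiplication only sums over S_n.

module GroupAlgebra {c ℓ′ : Level} (R : CommutativeRing c ℓ′) (n : ℕ) where
  open CommutativeRing R

  KS : Set c
  KS = Vec (Fin n) n → Carrier

  ΣR : ∀ {a} {A : Set a} → List A → (A → Carrier) → Carrier
  ΣR l f = foldr (λ x acc → f x + acc) 0# l

  δ : Vec (Fin n) n → KS
  δ u w = if (u ==V w) then 1# else 0#

  _⊕_ : KS → KS → KS
  (f ⊕ g) w = f w + g w

  ⊖_ : KS → KS
  (⊖ f) w = - (f w)

  _⊛_ : KS → KS → KS
  (f ⊛ g) w = ΣR (perms n) (λ u → ΣR (perms n) (λ v →
                 if ((u ∘ₚ v) ==V w) then f u * g v else 0#))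

  𝟙 : KS
  𝟙 = δ (idPerm n)

  ℕ→R : ℕ → Carrier
  ℕ→R zero    = 0#
  ℕ→R (suc k) = 1# + ℕ→R k

  ℤ→R : ℤ → Carrier
  ℤ→R (+ k)     = ℕ→R k
  ℤ→R -[1+ k ]  = - ℕ→R (suc k)

  ι : ℤ → KS
  ι k w = ℤ→R k * 𝟙 w

  w₀elt : KS
  w₀elt = δ (w₀ n)

  B : List ℕ → KS
  B α w = if (isPerm w ∧ (Des w ⊆ᵇ D α)) then 1# else 0#

  ∏ : List ℤ → (ℤ → KS) → KS
  ∏ l f = foldr (λ k acc → f k ⊛ acc) 𝟙 l

  _≈KS_ : KS → KS → Set ℓ′
  f ≈KS g = ∀ w → f w ≈ g w

  0KS : KS
  0KS _ = 0#

{-# OPTIONS --safe #-}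
-- A permutation w is read as the total order on [n] in which i precedes j when w(i) < w(j).
-- Coefficientwise, left multiplication by w₀B_α is the operator (T h)(r) = Σ_G h(G·r̄), where G
-- runs over the set compositions of type α, r̄ is the reversed order, and G·r compares first by
-- blocks of G and then by r.
--
-- For a set composition F let L_F g be the function r ↦ g(F·r), and let V_N be spanned by the
-- L_F g with n_α(F) ≥ N, where F may also reverse some of its blocks.  Since F·(G·r) = F·r when
-- F ⪯ G, and the common refinement of F and G is below strictly more compositions of type α
-- otherwise, T (L_F g) ≡ N · L_F̄ g modulo V_{N+1}, with N = n_α(F) and F̄ reversing the blocks
-- of F.  Hence (T − N)(T + N) sends L_F g into V_{N+1}, which suffices when both N and −N are
-- values of ñ_α.  If −ñ_α(F) is not a value, then every splitting of a block of F raises n_α,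
-- because it changes the sign in ñ_α.  The antipode identity Σ_{I ⊆ B} (−1)^|I| rev(r|_I) r|_{B∖I} = 0,
-- applied to each block B, then gives L_F̄ g ≡ (−1)^{n−ℓ(F)} L_F g modulo V_{N+1}, so T − ñ_α(F)
-- alone suffices.  The factors commute, so induction on N exhausts the product.
--
-- The statement for B_α w₀ follows by conjugation with w₀.
module Submission where

open import Defs
open import Level using (Level; _⊔_)
open import Algebra.Bundles using (CommutativeRing)
import Algebra.Properties.CommutativeSemigroup as CSG
import Algebra.Properties.Ring as RingP
import Data.Bool as Bool
open import Data.Bool using (Bool; true; false; T; T?; not; if_then_else_; _∧_)
open import Data.Bool.ListAction using (all)
import Data.Bool.Properties as BoolP
open import Data.Bool.Properties using (T-≡)
open import Data.Empty using (⊥; ⊥-elim)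
open import Data.Fin as Fin using (Fin; zero; suc; toℕ; fromℕ<; opposite; punchOut; _↑ˡ_; _↑ʳ_; splitAt)
import Data.Fin.Permutation as Perm
import Data.Fin.Properties as FinP
open import Data.Integer as ℤ using (ℤ)
import Data.Integer.Properties as ℤP
open import Data.List using (List)
open import Data.List.Base as List using ([]; _∷_; map; concatMap; filter; length; allFin; upTo; tabulate)
open import Data.List.Membership.Propositional using (_∈_; find; lose)
open import Data.List.Membership.Propositional.Properties using (∈-map⁺; ∈-map⁻; ∈-concatMap⁺; ∈-concatMap⁻; ∈-filter⁺; ∈-filter⁻; ∈-allFin; ∈-upTo⁺; ∈-lookup; ∈-deduplicate⁺)
import Data.List.Properties as ListP
open import Data.List.Relation.Unary.All as All using (All; []; _∷_)
import Data.List.Relation.Unary.All.Properties as AllP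
open import Data.List.Relation.Unary.AllPairs as AllPairs using ([]; _∷_)
import Data.List.Relation.Unary.AllPairs.Properties as AllPairsP
open import Data.List.Relation.Unary.Any as Any using (here; there; satisfied)
import Data.List.Relation.Unary.Any.Properties as AnyP
open import Data.List.Relation.Unary.Unique.Propositional using (Unique)
import Data.List.Relation.Unary.Unique.Propositional.Properties as UniqueP
open import Data.Nat as ℕ using (ℕ; zero; suc; _∸_; _≤_; _<_; _<ᵇ_; z≤n; s≤s)
open import Data.Nat.ListAction using (sum)
import Data.Nat.Properties as ℕP
open import Data.Product using (Σ; ∃; _×_; _,_; proj₁; proj₂)
import Data.Product.Properties as ProductP
open import Data.Sum using (inj₁; inj₂; [_,_]′)
open import Data.Unit using (⊤; tt)
open import Data.Vec as Vec using (Vec; []; _∷_; lookup)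
import Data.Vec.Properties as VecP
open import Function using (_∘_; id; case_of_; Equivalence)
open import Relation.Binary.Definitions using (tri<; tri≈; tri>)
open import Relation.Binary.PropositionalEquality using (_≡_; refl; sym; trans; cong; cong₂; subst; subst₂; module ≡-Reasoning)
import Relation.Binary.Reasoning.Setoid as SetoidReasoning
open import Relation.Nullary using (¬_; yes; no; does; contradiction; Dec)
open import Relation.Nullary.Decidable using (dec-true; dec-false)
open import Algebra.Properties.CommutativeMonoid.Sum ℕP.+-0-commutativeMonoid using (sum-permute; sum-cong-≗) renaming (sum to ∑)

-- The product supplies one factor for each value of ñ_α, whereas many faces share the same n_α. As
-- |ñ_α(F)| = n_α(F), a generator at level N may spend only the factors for N and -N, once each; all
-- others are reserved for other levels. That is the obstacle for which the antipode identity is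
-- brought in.
--
-- Values are compared as integers and mapped to 𝕜 only afterwards. The argument uses commuting
-- operators and a filtration, with neither division nor eigenvectors, so it covers rings in which N
-- and -N have the same image.
--
-- Functions of total orders take the place of group elements because a product of faces then
-- becomes a rule for comparing two elements i and j. Every identity between faces reduces to a case
-- distinction on one pair.

T⇒≡ : ∀ {b} → T b → b ≡ true
T⇒≡ = Equivalence.to T-≡

≡⇒T : ∀ {b} → b ≡ true → T b
≡⇒T = Equivalence.from T-≡

true≢false : ∀ {b : Bool} → b ≡ true → b ≡ false → ⊥
true≢false refl ()

¬true⇒false : ∀ {b} → ¬ (b ≡ true) → b ≡ false
¬true⇒false {true}  h = contradiction refl h
¬true⇒false {false} h = refl

bool-ext : ∀ {a b} → (a ≡ true → b ≡ true) → (b ≡ true → a ≡ true) → a ≡ b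
bool-ext {true}          p q = sym (p refl)
bool-ext {false} {true}  p q = q refl
bool-ext {false} {false} p q = refl

does-true : ∀ {p} {P : Set p} (d : Dec P) → does d ≡ true → P
does-true (yes p) _ = p

==F⇒≡ : ∀ {m} {i j : Fin m} → (i ==F j) ≡ true → i ≡ j
==F⇒≡ {i = i} {j} = does-true (i Fin.≟ j)

≡⇒==F : ∀ {m} {i j : Fin m} → i ≡ j → (i ==F j) ≡ true
≡⇒==F {i = i} {j} = dec-true (i Fin.≟ j)

≢⇒==F : ∀ {m} {i j : Fin m} → ¬ (i ≡ j) → (i ==F j) ≡ false
≢⇒==F {i = i} {j} = dec-false (i Fin.≟ j)

<ᵇ⇒< : ∀ {a b} → (a <ᵇ b) ≡ true → a < b
<ᵇ⇒< {a} {b} e = ℕP.<ᵇ⇒< a b (≡⇒T e)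

<⇒<ᵇ : ∀ {a b} → a < b → (a <ᵇ b) ≡ true
<⇒<ᵇ = T⇒≡ ∘ ℕP.<⇒<ᵇ

≮⇒<ᵇ : ∀ {a b} → ¬ (a < b) → (a <ᵇ b) ≡ false
≮⇒<ᵇ h = ¬true⇒false (h ∘ <ᵇ⇒<)

⇒ᵇ-elim : ∀ {a b} → (a ⇒ᵇ b) ≡ true → a ≡ true → b ≡ true
⇒ᵇ-elim h refl = h

⇒ᵇ-intro : ∀ {a b} → (a ≡ true → b ≡ true) → (a ⇒ᵇ b) ≡ true
⇒ᵇ-intro {true}  h = h refl
⇒ᵇ-intro {false} h = refl

all-allFin⁻ : ∀ {n} (p : Fin n → Bool) → all p (allFin n) ≡ true → ∀ i → p i ≡ true
all-allFin⁻ p h i = T⇒≡ (All.lookup (AllP.all⁺ p _ (≡⇒T h)) (∈-allFin i))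

all-allFin⁺ : ∀ {n} (p : Fin n → Bool) → (∀ i → p i ≡ true) → all p (allFin n) ≡ true
all-allFin⁺ {n} p h = T⇒≡ (AllP.all⁻ p (All.universal (≡⇒T ∘ h) (allFin n)))

-- Enumerations of permutations and set compositions

record InjV {m n} (v : Vec (Fin m) n) : Set where
  constructor injV
  field inj : ∀ {i j} → lookup v i ≡ lookup v j → i ≡ j

record SurjV {m n} (v : Vec (Fin m) n) : Set where
  constructor surjV
  field surj : ∀ j → ∃ λ i → lookup v i ≡ j

open InjV public
open SurjV public

isInjective⁻ : ∀ {m n} (v : Vec (Fin m) n) → isInjective v ≡ true → InjV v
isInjective⁻ v h = injV λ {i} {j} e →
  ==F⇒≡ (⇒ᵇ-elim (all-allFin⁻ _ (all-allFin⁻ _ h i) j) (≡⇒==F e))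

isInjective⁺ : ∀ {m n} (v : Vec (Fin m) n) → InjV v → isInjective v ≡ true
isInjective⁺ {n = n} v h = all-allFin⁺ {n} _ λ i → all-allFin⁺ {n} _ λ j →
  ⇒ᵇ-intro (≡⇒==F ∘ inj h {i} {j} ∘ ==F⇒≡)

isSurjective⁻ : ∀ {m n} (v : Vec (Fin m) n) → isSurjective v ≡ true → SurjV v
isSurjective⁻ v h = surjV λ j →
  let i , e = satisfied (AnyP.any⁻ (λ i → lookup v i ==F j) (allFin _) (≡⇒T (all-allFin⁻ _ h j)))
  in i , ==F⇒≡ (T⇒≡ e)

isSurjective⁺ : ∀ {m n} (v : Vec (Fin m) n) → SurjV v → isSurjective v ≡ true
isSurjective⁺ v h = all-allFin⁺ _ λ j →
  let i , e = surj h j in T⇒≡ (AnyP.any⁺ _ (lose (∈-allFin i) (≡⇒T (≡⇒==F e))))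

⪯ᵇ⁻ : ∀ {n} (F G : SetComp n) → (F ⪯ᵇ G) ≡ true →
      ∀ i j → lookup (proj₂ F) i ≡ lookup (proj₂ F) j → lookup (proj₂ G) i ≡ lookup (proj₂ G) j
⪯ᵇ⁻ F G h i j e = ==F⇒≡ (⇒ᵇ-elim (all-allFin⁻ _ (all-allFin⁻ _ h i) j) (≡⇒==F e))

⪯ᵇ⁺ : ∀ {n} (F G : SetComp n) →
      (∀ i j → lookup (proj₂ F) i ≡ lookup (proj₂ F) j → lookup (proj₂ G) i ≡ lookup (proj₂ G) j) →
      (F ⪯ᵇ G) ≡ true
⪯ᵇ⁺ F G h = all-allFin⁺ _ λ i → all-allFin⁺ _ λ j → ⇒ᵇ-intro (≡⇒==F ∘ h i j ∘ ==F⇒≡)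

lookup-ext : ∀ {a} {A : Set a} {n} {u v : Vec A n} → (∀ i → lookup u i ≡ lookup v i) → u ≡ v
lookup-ext {u = []}     {[]}     h = refl
lookup-ext {u = x ∷ u} {y ∷ v} h = cong₂ _∷_ (h zero) (lookup-ext (h ∘ suc))

-- The map `g` reads off from an entry the index of the list that contains it, so lists with
-- distinct indices are disjoint.
concatMap-unique : ∀ {a b} {A : Set a} {B : Set b} (f : A → List B) (g : B → A) →
  (∀ {x y} → y ∈ f x → g y ≡ x) → ∀ {xs} → Unique xs → (∀ x → Unique (f x)) → Unique (concatMap f xs)
concatMap-unique f g gf u uf = UniqueP.concat⁺ (AllP.map⁺ (All.universal uf _))
  (AllPairsP.map⁺ {f = f} (AllPairs.map (λ x≢y {_} (p , q) → x≢y (trans (sym (gf p)) (gf q))) u))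

∈-allVecs : ∀ {m n} (v : Vec (Fin m) n) → v ∈ allVecs m n
∈-allVecs []      = here refl
∈-allVecs (x ∷ v) = ∈-concatMap⁺ _ (lose (∈-allFin x) (∈-map⁺ (x ∷_) (∈-allVecs v)))

allVecs-unique : ∀ m n → Unique (allVecs m n)
allVecs-unique m zero    = [] ∷ []
allVecs-unique m (suc n) = concatMap-unique _ Vec.head head≡ (UniqueP.allFin⁺ m)
  (λ x → UniqueP.map⁺ VecP.∷-injectiveʳ (allVecs-unique m n))
  where
  head≡ : ∀ {x : Fin m} {y} → y ∈ map (x ∷_) (allVecs m n) → Vec.head y ≡ x
  head≡ {x} p with _ , _ , refl ← ∈-map⁻ (x ∷_) p = refl

∈-perms⁺ : ∀ {n} {v : Vec (Fin n) n} → InjV v → v ∈ perms n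
∈-perms⁺ {v = v} h = ∈-filter⁺ _ (∈-allVecs v) (≡⇒T (isInjective⁺ v h))

∈-perms⁻ : ∀ {n} {v : Vec (Fin n) n} → v ∈ perms n → InjV v
∈-perms⁻ {n} {v} p = isInjective⁻ v (T⇒≡ (proj₂ (∈-filter⁻ (λ v → T? (isPerm v)) {xs = allVecs n n} p)))

perms-unique : ∀ n → Unique (perms n)
perms-unique n = UniqueP.filter⁺ _ (allVecs-unique n n)

surj⇒≤ : ∀ {m n} {v : Vec (Fin m) n} → SurjV v → m ≤ n
surj⇒≤ {v = v} s = FinP.injective⇒≤ {f = proj₁ ∘ surj s}
  (λ {i} {j} e → trans (sym (proj₂ (surj s i))) (trans (cong (lookup v) e) (proj₂ (surj s j))))

surjections : ∀ m n → List (Vec (Fin m) n)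
surjections m n = filter (λ v → T? (isSurjective v)) (allVecs m n)

∈-setComps⁺ : ∀ {m n} {v : Vec (Fin m) n} → SurjV v → (m , v) ∈ setComps n
∈-setComps⁺ {m} {v = v} s = ∈-concatMap⁺ _ (lose (∈-upTo⁺ (s≤s (surj⇒≤ s)))
  (∈-map⁺ (m ,_) (∈-filter⁺ _ (∈-allVecs v) (≡⇒T (isSurjective⁺ v s)))))

∈-setComps⁻ : ∀ {m n} {v : Vec (Fin m) n} → (m , v) ∈ setComps n → SurjV v
∈-setComps⁻ {n = n} {v} p with satisfied (∈-concatMap⁻ (λ m → map (m ,_) (surjections m _)) {xs = upTo (suc n)} p)
... | m , q with v , r , refl ← ∈-map⁻ (m ,_) q =
  isSurjective⁻ v (T⇒≡ (proj₂ (∈-filter⁻ (λ v → T? (isSurjective v)) {xs = allVecs m _} r)))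

setComps-unique : ∀ n → Unique (setComps n)
setComps-unique n = concatMap-unique (λ m → map (m ,_) (surjections m n)) proj₁ ℓ≡ (UniqueP.upTo⁺ (suc n))
  (λ m → UniqueP.map⁺ (λ { refl → refl }) (UniqueP.filter⁺ _ (allVecs-unique m n)))
  where
  ℓ≡ : ∀ {m} {y} → y ∈ map (m ,_) (surjections m n) → proj₁ y ≡ m
  ℓ≡ {m} p with _ , _ , refl ← ∈-map⁻ (m ,_) p = refl

injective⇒surjective : ∀ {n} {f : Fin n → Fin n} → (∀ {i j} → f i ≡ f j → i ≡ j) → ∀ p → ∃ λ i → f i ≡ p
injective⇒surjective {zero} inj ()
injective⇒surjective {suc n} {f} inj p with FinP.any? (λ i → f i Fin.≟ p)
... | yes r = r
-- If `p` were missed, punching it out would inject a set into one with fewer elements.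
... | no ¬r = contradiction (FinP.injective⇒≤ {f = λ i → punchOut {i = p} (λ e → ¬r (i , sym e))}
        (λ e → inj (FinP.punchOut-injective {i = p} _ _ e))) ℕP.1+n≰n

-- Counting with Boolean predicates

cnt : ∀ {n} → (Fin n → Bool) → ℕ
cnt P = ∑ (λ i → if P i then 1 else 0)

cnt-cong : ∀ {n} {P Q : Fin n → Bool} → (∀ i → P i ≡ Q i) → cnt P ≡ cnt Q
cnt-cong h = sum-cong-≗ (λ i → cong (λ b → if b then 1 else 0) (h i))

if-mono : ∀ {p q : Bool} → (p ≡ true → q ≡ true) → (if p then 1 else 0) ≤ (if q then 1 else 0)
if-mono {true}  h rewrite h refl = ℕP.≤-refl
if-mono {false} h = z≤n

cnt-mono : ∀ {n} {P Q : Fin n → Bool} → (∀ i → P i ≡ true → Q i ≡ true) → cnt P ≤ cnt Q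
cnt-mono {zero}  h = z≤n
cnt-mono {suc n} h = ℕP.+-mono-≤ (if-mono (h zero)) (cnt-mono (h ∘ suc))

cnt-mono-< : ∀ {n} {P Q : Fin n → Bool} → (∀ i → P i ≡ true → Q i ≡ true) →
             ∀ x → P x ≡ false → Q x ≡ true → cnt P < cnt Q
cnt-mono-< h zero    p q rewrite p | q = s≤s (cnt-mono (h ∘ suc))
cnt-mono-< h (suc x) p q = ℕP.+-mono-≤-< (if-mono (h zero)) (cnt-mono-< (h ∘ suc) x p q)

cnt-all : ∀ n → cnt {n} (λ _ → true) ≡ n
cnt-all zero    = refl
cnt-all (suc n) = cong suc (cnt-all n)

cnt-none : ∀ n → cnt {n} (λ _ → false) ≡ 0
cnt-none zero    = refl
cnt-none (suc n) = cnt-none n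

cnt-<ᵇ : ∀ {n k} → k ≤ n → cnt {n} (λ p → toℕ p <ᵇ k) ≡ k
cnt-<ᵇ {n} z≤n = cnt-none n
cnt-<ᵇ (s≤s h) = cong suc (cnt-<ᵇ h)

cnt-permute : ∀ {n} (P : Fin n → Bool) {v : Vec (Fin n) n} → InjV v → cnt (P ∘ lookup v) ≡ cnt P
cnt-permute P {v} v-inj = sym (sum-permute _ (Perm.permutation (lookup v) (proj₁ ∘ onto)
    (proj₂ ∘ onto) (λ i → inj v-inj (proj₂ (onto (lookup v i))))))
  where
  onto : ∀ p → ∃ λ i → lookup v i ≡ p
  onto = injective⇒surjective (inj v-inj)

length-filter-allFin : ∀ {n} (P : Fin n → Bool) → length (filter (T? ∘ P) (allFin n)) ≡ cnt P
length-filter-allFin P = go id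
  where
  go : ∀ {k} (f : Fin k → Fin _) → length (filter (T? ∘ P) (tabulate f)) ≡ cnt (P ∘ f)
  go {zero}  f = refl
  go {suc k} f with P (f zero)
  ... | true  = cong suc (go (f ∘ suc))
  ... | false = go (f ∘ suc)

-- Total orders

-- Orders are stored as Boolean matrices, so that entrywise agreement gives propositional equality,
-- equality is decidable, and every function of orders respects it. That a matrix is a strict total
-- order is the separate predicate `STO`.
Ord : ℕ → Set
Ord n = Vec (Vec Bool n) n

mk : ∀ {n} → (Fin n → Fin n → Bool) → Ord n
mk f = Vec.tabulate (λ i → Vec.tabulate (f i))

at : ∀ {n} → Ord n → Fin n → Fin n → Bool
at r i j = lookup (lookup r i) j

at-mk : ∀ {n} (f : Fin n → Fin n → Bool) i j → at (mk f) i j ≡ f i j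
at-mk f i j = trans (cong (λ v → lookup v j) (VecP.lookup∘tabulate _ i)) (VecP.lookup∘tabulate _ j)

at-ext : ∀ {n} {r s : Ord n} → (∀ i j → at r i j ≡ at s i j) → r ≡ s
at-ext h = lookup-ext λ i → lookup-ext (h i)

record STO {n} (r : Ord n) : Set where
  constructor sto
  field
    irrefl : ∀ i → at r i i ≡ false
    total  : ∀ {i j} → ¬ (i ≡ j) → at r i j ≡ false → at r j i ≡ true
    trans< : ∀ {i j k} → at r i j ≡ true → at r j k ≡ true → at r i k ≡ true

open STO public

STO-mk : ∀ {n} {f : Fin n → Fin n → Bool} →
         (∀ i → f i i ≡ false) →
         (∀ {i j} → ¬ (i ≡ j) → f i j ≡ false → f j i ≡ true) →
         (∀ {i j k} → f i j ≡ true → f j k ≡ true → f i k ≡ true) → STO (mk f)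
STO-mk {f = f} irr tot tr .irrefl i = trans (at-mk f i i) (irr i)
STO-mk {f = f} irr tot tr .total {i} {j} ne p = trans (at-mk f j i) (tot ne (trans (sym (at-mk f i j)) p))
STO-mk {f = f} irr tot tr .trans< {i} {j} {k} p q =
  trans (at-mk f i k) (tr (trans (sym (at-mk f i j)) p) (trans (sym (at-mk f j k)) q))

ord : ∀ {m n} → Vec (Fin m) n → Ord n
ord v = mk λ i j → toℕ (lookup v i) <ᵇ toℕ (lookup v j)

STO-ord : ∀ {n} {v : Vec (Fin n) n} → InjV v → STO (ord v)
STO-ord {v = v} v-inj = STO-mk
  (λ i → ≮⇒<ᵇ (ℕP.n≮n (toℕ (lookup v i))))
  (λ {i} {j} ne p → <⇒<ᵇ (ℕP.≤∧≢⇒< (ℕP.≮⇒≥ (λ q → true≢false (<⇒<ᵇ q) p))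
                                (λ e → ne (inj v-inj (sym (FinP.toℕ-injective e))))))
  (λ {i} {j} {k} p q → <⇒<ᵇ (ℕP.<-trans (<ᵇ⇒< {toℕ (lookup v i)} {toℕ (lookup v j)} p)
                                        (<ᵇ⇒< {b = toℕ (lookup v k)} q)))

-- Lets `rank` be defined on all matrices. On a strict total order the count is below `n`
-- (`cnt-below<`), so the default `i` is never taken there.
clamp : ∀ {n} → Fin n → ℕ → Fin n
clamp {n} i k with k ℕ.<? n
... | yes k<n = fromℕ< k<n
... | no  _   = i

toℕ-clamp : ∀ {n} (i : Fin n) {k} → k < n → toℕ (clamp i k) ≡ k
toℕ-clamp {n} i {k} h with k ℕ.<? n
... | yes k<n = FinP.toℕ-fromℕ< k<n
... | no  ¬p  = contradiction h ¬p

rank : ∀ {n} → Ord n → Vec (Fin n) n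
rank r = Vec.tabulate (λ i → clamp i (cnt (λ j → at r j i)))

cnt-below< : ∀ {n} {r : Ord n} → STO r → ∀ i → cnt (λ j → at r j i) < n
cnt-below< {n} {r} R i = subst (cnt (λ j → at r j i) <_) (cnt-all n) (cnt-mono-< {P = λ j → at r j i} (λ _ _ → refl) i (irrefl R i) refl)

toℕ-rank : ∀ {n} {r : Ord n} → STO r → ∀ i → toℕ (lookup (rank r) i) ≡ cnt (λ j → at r j i)
toℕ-rank R i = trans (cong toℕ (VecP.lookup∘tabulate _ i)) (toℕ-clamp i (cnt-below< R i))

rank-mono : ∀ {n} {r : Ord n} → STO r → ∀ {i j} → at r i j ≡ true →
            toℕ (lookup (rank r) i) < toℕ (lookup (rank r) j)
rank-mono R {i} {j} p = subst₂ _<_ (sym (toℕ-rank R i)) (sym (toℕ-rank R j))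
  (cnt-mono-< (λ k q → trans< R {k} q p) i (irrefl R i) p)

rank-injective : ∀ {n} {r : Ord n} → STO r → InjV (rank r)
rank-injective {r = r} R = injV inject
  where
  inject : ∀ {i j} → lookup (rank r) i ≡ lookup (rank r) j → i ≡ j
  inject {i} {j} e with i Fin.≟ j | at r i j in p
  ... | yes i≡j | _     = i≡j
  ... | no  _   | true  = contradiction (rank-mono R p) (ℕP.<-irrefl (cong toℕ e))
  ... | no  i≢j | false = contradiction (rank-mono R (total R i≢j p)) (ℕP.<-irrefl (cong toℕ (sym e)))

ord-rank : ∀ {n} {r : Ord n} → STO r → ord (rank r) ≡ r
ord-rank {r = r} R = at-ext λ i j → trans (at-mk _ i j) (bool-ext (λ p → back (<ᵇ⇒< p)) (<⇒<ᵇ ∘ rank-mono R))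
  where
  back : ∀ {i j} → toℕ (lookup (rank r) i) < toℕ (lookup (rank r) j) → at r i j ≡ true
  back {i} {j} p with i Fin.≟ j | at r i j in q
  ... | yes refl | _     = contradiction p (ℕP.n≮n _)
  ... | no  _    | true  = refl
  ... | no  i≢j  | false = contradiction (rank-mono R (total R i≢j q)) (ℕP.<⇒≯ p)

cnt-below : ∀ {n} {v : Vec (Fin n) n} → InjV v → ∀ k → k ≤ n → cnt (λ j → toℕ (lookup v j) <ᵇ k) ≡ k
cnt-below v-inj k k≤n = trans (cnt-permute (λ p → toℕ p <ᵇ k) v-inj) (cnt-<ᵇ k≤n)

rank-ord : ∀ {n} {v : Vec (Fin n) n} → InjV v → rank (ord v) ≡ v
rank-ord {v = v} v-inj = lookup-ext λ i → FinP.toℕ-injective (trans (toℕ-rank (STO-ord v-inj) i)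
  (trans (cnt-cong (λ j → at-mk (λ i j → toℕ (lookup v i) <ᵇ toℕ (lookup v j)) j i)) (cnt-below v-inj _ (ℕP.<⇒≤ (FinP.toℕ<n (lookup v i))))))

bar : ∀ {n} → Ord n → Ord n
bar r = mk λ i j → at r j i

at-bar : ∀ {n} (r : Ord n) i j → at (bar r) i j ≡ at r j i
at-bar r = at-mk _

bar-bar : ∀ {n} (r : Ord n) → bar (bar r) ≡ r
bar-bar r = at-ext λ i j → trans (at-bar (bar r) i j) (at-bar r j i)

STO-bar : ∀ {n} {r : Ord n} → STO r → STO (bar r)
STO-bar {r = r} R = STO-mk (irrefl R) (λ ne → total R (ne ∘ sym)) (λ p q → trans< R q p)

-- Composition of permutations and the longest element

lookup-∘ₚ : ∀ {n} (σ τ : Vec (Fin n) n) i → lookup (σ ∘ₚ τ) i ≡ lookup σ (lookup τ i)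
lookup-∘ₚ σ τ = VecP.lookup∘tabulate _

∘ₚ-injective : ∀ {n} {σ τ : Vec (Fin n) n} → InjV σ → InjV τ → InjV (σ ∘ₚ τ)
∘ₚ-injective {σ = σ} {τ} p q = injV λ {i} {j} e → inj q (inj p (trans (sym (lookup-∘ₚ σ τ i)) (trans e (lookup-∘ₚ σ τ j))))

∘ₚ-assoc : ∀ {n} (ρ σ τ : Vec (Fin n) n) → (ρ ∘ₚ σ) ∘ₚ τ ≡ ρ ∘ₚ (σ ∘ₚ τ)
∘ₚ-assoc ρ σ τ = lookup-ext λ i → begin
  lookup ((ρ ∘ₚ σ) ∘ₚ τ) i         ≡⟨ lookup-∘ₚ (ρ ∘ₚ σ) τ i ⟩
  lookup (ρ ∘ₚ σ) (lookup τ i)     ≡⟨ lookup-∘ₚ ρ σ _ ⟩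
  lookup ρ (lookup σ (lookup τ i)) ≡⟨ cong (lookup ρ) (lookup-∘ₚ σ τ i) ⟨
  lookup ρ (lookup (σ ∘ₚ τ) i)     ≡⟨ lookup-∘ₚ ρ (σ ∘ₚ τ) i ⟨
  lookup (ρ ∘ₚ (σ ∘ₚ τ)) i         ∎
  where open ≡-Reasoning

idPerm-∘ₚ : ∀ {n} (v : Vec (Fin n) n) → idPerm n ∘ₚ v ≡ v
idPerm-∘ₚ v = lookup-ext λ i → trans (lookup-∘ₚ (idPerm _) v i) (VecP.lookup∘tabulate id _)

∘ₚ-idPerm : ∀ {n} (v : Vec (Fin n) n) → v ∘ₚ idPerm n ≡ v
∘ₚ-idPerm {n} v = lookup-ext λ i → trans (lookup-∘ₚ v (idPerm n) i) (cong (lookup v) (VecP.lookup∘tabulate id i))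

idPerm-injective : ∀ n → InjV (idPerm n)
idPerm-injective n = injV λ {i} {j} e → trans (sym (VecP.lookup∘tabulate id i)) (trans e (VecP.lookup∘tabulate id j))

w₀-involutive : ∀ n → w₀ n ∘ₚ w₀ n ≡ idPerm n
w₀-involutive n = lookup-ext λ i → begin
  lookup (w₀ n ∘ₚ w₀ n) i          ≡⟨ lookup-∘ₚ (w₀ n) (w₀ n) i ⟩
  lookup (w₀ n) (lookup (w₀ n) i)  ≡⟨ VecP.lookup∘tabulate opposite _ ⟩
  opposite (lookup (w₀ n) i)       ≡⟨ cong opposite (VecP.lookup∘tabulate opposite i) ⟩
  opposite (opposite i)            ≡⟨ FinP.opposite-involutive i ⟩
  i                                ≡⟨ VecP.lookup∘tabulate id i ⟨
  lookup (idPerm n) i              ∎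
  where open ≡-Reasoning

left-inverse⇒injective : ∀ {n} {u v : Vec (Fin n) n} → u ∘ₚ v ≡ idPerm n → InjV v
left-inverse⇒injective {n} {u} {v} e = injV λ {i} {j} p → inj (idPerm-injective n) (begin
  lookup (idPerm n) i   ≡⟨ cong (λ w → lookup w i) e ⟨
  lookup (u ∘ₚ v) i     ≡⟨ lookup-∘ₚ u v i ⟩
  lookup u (lookup v i) ≡⟨ cong (lookup u) p ⟩
  lookup u (lookup v j) ≡⟨ lookup-∘ₚ u v j ⟨
  lookup (u ∘ₚ v) j     ≡⟨ cong (λ w → lookup w j) e ⟩
  lookup (idPerm n) j   ∎)
  where open ≡-Reasoning

w₀-injective : ∀ n → InjV (w₀ n)
w₀-injective n = left-inverse⇒injective {u = w₀ n} (w₀-involutive n)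

w₀-∘ₚ-w₀ : ∀ {n} (v : Vec (Fin n) n) → w₀ n ∘ₚ (w₀ n ∘ₚ v) ≡ v
w₀-∘ₚ-w₀ {n} v = trans (sym (∘ₚ-assoc (w₀ n) (w₀ n) v)) (trans (cong (_∘ₚ v) (w₀-involutive n)) (idPerm-∘ₚ v))

opposite-anti : ∀ {n} {a b : Fin n} → toℕ a < toℕ b → toℕ (opposite b) < toℕ (opposite a)
opposite-anti {n} {a} {b} h = subst₂ _<_ (sym (FinP.opposite-prop b)) (sym (FinP.opposite-prop a))
  (ℕP.∸-monoʳ-< (s≤s h) (FinP.toℕ<n b))

opposite-<ᵇ : ∀ {n} (a b : Fin n) → (toℕ (opposite a) <ᵇ toℕ (opposite b)) ≡ (toℕ b <ᵇ toℕ a)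
opposite-<ᵇ a b = bool-ext
  (λ p → <⇒<ᵇ (subst₂ (λ x y → toℕ x < toℕ y) (FinP.opposite-involutive b) (FinP.opposite-involutive a)
                 (opposite-anti (<ᵇ⇒< p))))
  (λ p → <⇒<ᵇ (opposite-anti (<ᵇ⇒< {toℕ b} p)))

ord-w₀ : ∀ {n} (v : Vec (Fin n) n) → ord (w₀ n ∘ₚ v) ≡ bar (ord v)
ord-w₀ {n} v = at-ext λ i j → begin
  at (ord (w₀ n ∘ₚ v)) i j                                         ≡⟨ at-mk _ i j ⟩
  toℕ (lookup (w₀ n ∘ₚ v) i) <ᵇ toℕ (lookup (w₀ n ∘ₚ v) j)         ≡⟨ cong₂ (λ a b → toℕ a <ᵇ toℕ b) (opp i) (opp j) ⟩
  toℕ (opposite (lookup v i)) <ᵇ toℕ (opposite (lookup v j))       ≡⟨ opposite-<ᵇ (lookup v i) (lookup v j) ⟩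
  toℕ (lookup v j) <ᵇ toℕ (lookup v i)                             ≡⟨ at-mk _ j i ⟨
  at (ord v) j i                                                   ≡⟨ at-bar (ord v) i j ⟨
  at (bar (ord v)) i j                                             ∎
  where
  open ≡-Reasoning
  opp : ∀ i → lookup (w₀ n ∘ₚ v) i ≡ opposite (lookup v i)
  opp i = trans (lookup-∘ₚ (w₀ n) v i) (VecP.lookup∘tabulate opposite _)

-- Set compositions acting on orders

_◁_ : ∀ {m n} → Vec (Fin m) n → Ord n → Ord n
G ◁ r = mk λ i j → if lookup G i ==F lookup G j then at r i j else (toℕ (lookup G i) <ᵇ toℕ (lookup G j))

at-◁-same : ∀ {m n} (G : Vec (Fin m) n) r {i j} → lookup G i ≡ lookup G j → at (G ◁ r) i j ≡ at r i j
at-◁-same G r {i} {j} e rewrite at-mk (λ i j → if lookup G i ==F lookup G j then at r i j else (toℕ (lookup G i) <ᵇ toℕ (lookup G j))) i j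
  | ≡⇒==F e = refl

at-◁-diff : ∀ {m n} (G : Vec (Fin m) n) r {i j} → ¬ (lookup G i ≡ lookup G j) →
            at (G ◁ r) i j ≡ (toℕ (lookup G i) <ᵇ toℕ (lookup G j))
at-◁-diff G r {i} {j} e rewrite at-mk (λ i j → if lookup G i ==F lookup G j then at r i j else (toℕ (lookup G i) <ᵇ toℕ (lookup G j))) i j
  | ≢⇒==F e = refl

at-◁-≤ : ∀ {m n} (G : Vec (Fin m) n) r {i j} → at (G ◁ r) i j ≡ true → toℕ (lookup G i) ≤ toℕ (lookup G j)
at-◁-≤ G r {i} {j} p with lookup G i Fin.≟ lookup G j
... | yes e = ℕP.≤-reflexive (cong toℕ e)
... | no ne = ℕP.<⇒≤ (<ᵇ⇒< (trans (sym (at-◁-diff G r ne)) p))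

at-◁-< : ∀ {m n} (G : Vec (Fin m) n) r {i j} → toℕ (lookup G i) < toℕ (lookup G j) → at (G ◁ r) i j ≡ true
at-◁-< G r p = trans (at-◁-diff G r (λ e → ℕP.<-irrefl (cong toℕ e) p)) (<⇒<ᵇ p)

STO-◁ : ∀ {m n} (G : Vec (Fin m) n) {r : Ord n} → STO r → STO (G ◁ r)
STO-◁ G {r} R .irrefl i = trans (at-◁-same G r refl) (irrefl R i)
STO-◁ G {r} R .total {i} {j} ne p with lookup G i Fin.≟ lookup G j
... | yes e = trans (at-◁-same G r (sym e)) (total R ne (trans (sym (at-◁-same G r e)) p))
... | no ¬e = at-◁-< G r (ℕP.≤∧≢⇒< (ℕP.≮⇒≥ (λ q → true≢false (at-◁-< G r q) p)) (λ e → ¬e (FinP.toℕ-injective (sym e))))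
STO-◁ G {r} R .trans< {i} {j} {k} p q with ℕP.m≤n⇒m<n∨m≡n (at-◁-≤ G r p) | ℕP.m≤n⇒m<n∨m≡n (at-◁-≤ G r q)
... | inj₁ a | _ = at-◁-< G r (ℕP.<-≤-trans a (at-◁-≤ G r q))
... | inj₂ a | inj₁ b = at-◁-< G r (ℕP.≤-<-trans (ℕP.≤-reflexive a) b)
... | inj₂ a | inj₂ b = trans (at-◁-same G r (trans a′ b′))
        (trans< R (trans (sym (at-◁-same G r a′)) p) (trans (sym (at-◁-same G r b′)) q))
  where
  a′ = FinP.toℕ-injective a
  b′ = FinP.toℕ-injective b

cnt-∃ : ∀ {n} (P : Fin n → Bool) → 0 < cnt P → ∃ λ i → P i ≡ true
cnt-∃ {suc n} P h with P zero in e
... | true  = zero , e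
... | false = let i , p = cnt-∃ (P ∘ suc) h in suc i , p

cnt-++ : ∀ a {s} (P : Fin (a ℕ.+ s) → Bool) → cnt P ≡ cnt (P ∘ (_↑ˡ s)) ℕ.+ cnt (P ∘ (a ↑ʳ_))
cnt-++ zero    P = refl
cnt-++ (suc a) P = trans (cong ((if P zero then 1 else 0) ℕ.+_) (cnt-++ a (P ∘ suc))) (sym (ℕP.+-assoc (if P zero then 1 else 0) _ _))

cnt-+ : ∀ {n} {P Q S : Fin n → Bool} →
        (∀ i → (if S i then 1 else 0) ≡ (if P i then 1 else 0) ℕ.+ (if Q i then 1 else 0)) →
        cnt S ≡ cnt P ℕ.+ cnt Q
cnt-+ {zero}  h = refl
cnt-+ {suc n} {P} {Q} {S} h = begin
  _ ℕ.+ cnt (S ∘ suc)                           ≡⟨ cong₂ ℕ._+_ (h zero) (cnt-+ (h ∘ suc)) ⟩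
  (p ℕ.+ q) ℕ.+ (cnt (P ∘ suc) ℕ.+ cnt (Q ∘ suc))   ≡⟨ ℕP.+-assoc p q _ ⟩
  p ℕ.+ (q ℕ.+ (cnt (P ∘ suc) ℕ.+ cnt (Q ∘ suc)))   ≡⟨ cong (p ℕ.+_) (ℕP.+-assoc q _ _) ⟨
  p ℕ.+ (q ℕ.+ cnt (P ∘ suc) ℕ.+ cnt (Q ∘ suc))     ≡⟨ cong (λ x → p ℕ.+ (x ℕ.+ cnt (Q ∘ suc))) (ℕP.+-comm q _) ⟩
  p ℕ.+ (cnt (P ∘ suc) ℕ.+ q ℕ.+ cnt (Q ∘ suc))     ≡⟨ cong (p ℕ.+_) (ℕP.+-assoc (cnt (P ∘ suc)) q _) ⟩
  p ℕ.+ (cnt (P ∘ suc) ℕ.+ (q ℕ.+ cnt (Q ∘ suc)))   ≡⟨ ℕP.+-assoc p _ _ ⟨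
  (p ℕ.+ cnt (P ∘ suc)) ℕ.+ (q ℕ.+ cnt (Q ∘ suc))   ∎
  where
  open ≡-Reasoning
  p = if P zero then 1 else 0
  q = if Q zero then 1 else 0

<ᵇ-suc : ∀ a j → (if a <ᵇ suc j then 1 else 0) ≡ (if a <ᵇ j then 1 else 0) ℕ.+ (if does (a ℕ.≟ j) then 1 else 0)
<ᵇ-suc a j with ℕP.<-cmp a j
... | tri< a<j a≢j _ rewrite <⇒<ᵇ (ℕP.m<n⇒m<1+n a<j) | <⇒<ᵇ a<j | dec-false (a ℕ.≟ j) a≢j = refl
... | tri≈ a≮j refl _ rewrite <⇒<ᵇ (ℕP.n<1+n a) | ≮⇒<ᵇ a≮j | dec-true (a ℕ.≟ a) refl = refl
... | tri> a≮j a≢j j<a rewrite ≮⇒<ᵇ (ℕP.<⇒≱ (s≤s j<a)) | ≮⇒<ᵇ a≮j | dec-false (a ℕ.≟ j) a≢j = refl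

-- If `i` is in `S`, so are the v(i) + 1 elements up to `i`; if not, all of `S` is among the v(i)
-- elements before `i`. So a set closed downwards along `v` is determined by its size.
cnt-initial : ∀ {n} {v : Vec (Fin n) n} → InjV v → (S : Fin n → Bool) →
  (∀ {i k} → S i ≡ true → toℕ (lookup v k) < toℕ (lookup v i) → S k ≡ true) →
  ∀ i → S i ≡ (toℕ (lookup v i) <ᵇ cnt S)
cnt-initial {n} {v} v-inj S down i = bool-ext inside outside
  where
  inside : S i ≡ true → (toℕ (lookup v i) <ᵇ cnt S) ≡ true
  inside p = <⇒<ᵇ (ℕP.≤-trans (ℕP.≤-reflexive (sym (cnt-below v-inj _ (FinP.toℕ<n (lookup v i))))) (cnt-mono below⇒S))
    where
    below⇒S : ∀ k → (toℕ (lookup v k) <ᵇ suc (toℕ (lookup v i))) ≡ true → S k ≡ true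
    below⇒S k q with ℕP.m≤n⇒m<n∨m≡n (ℕP.≤-pred (<ᵇ⇒< {toℕ (lookup v k)} q))
    ... | inj₁ lt = down p lt
    ... | inj₂ eq = subst (λ x → S x ≡ true) (sym (inj v-inj (FinP.toℕ-injective eq))) p
  outside : (toℕ (lookup v i) <ᵇ cnt S) ≡ true → S i ≡ true
  outside q with S i in e
  ... | true  = refl
  ... | false = contradiction (<ᵇ⇒< {toℕ (lookup v i)} q) (ℕP.≤⇒≯ (ℕP.≤-trans (cnt-mono S⇒below)
        (ℕP.≤-reflexive (cnt-below v-inj _ (ℕP.<⇒≤ (FinP.toℕ<n (lookup v i)))))))
    where
    S⇒below : ∀ k → S k ≡ true → (toℕ (lookup v k) <ᵇ toℕ (lookup v i)) ≡ true
    S⇒below k s = <⇒<ᵇ (ℕP.≰⇒> λ le → case ℕP.m≤n⇒m<n∨m≡n le of λ where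
      (inj₁ lt) → true≢false (down s lt) e
      (inj₂ eq) → true≢false (subst (λ x → S x ≡ true) (sym (inj v-inj (FinP.toℕ-injective eq))) s) e)

-- Segments of a composition and descents

Mono : ∀ {n} → Vec (Fin n) n → SetComp n → Set
Mono v (_ , G) = ∀ i k → toℕ (lookup v i) < toℕ (lookup v k) → toℕ (lookup G i) ≤ toℕ (lookup G k)

blockSize≡cnt : ∀ {m n} (G : Vec (Fin m) n) j → blockSize G j ≡ cnt (λ i → lookup G i ==F j)
blockSize≡cnt G j = length-filter-allFin (λ i → lookup G i ==F j)

cnt-<-step : ∀ {m n} (G : Vec (Fin m) n) (j : Fin m) →
  cnt (λ i → toℕ (lookup G i) <ᵇ suc (toℕ j)) ≡ cnt (λ i → toℕ (lookup G i) <ᵇ toℕ j) ℕ.+ cnt (λ i → lookup G i ==F j)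
cnt-<-step G j = cnt-+ λ i → trans (<ᵇ-suc (toℕ (lookup G i)) (toℕ j)) (cong (λ b → (if toℕ (lookup G i) <ᵇ toℕ j then 1 else 0) ℕ.+ (if b then 1 else 0))
  (bool-ext (λ p → ≡⇒==F (FinP.toℕ-injective (does-true (toℕ (lookup G i) ℕ.≟ toℕ j) p)))
            (λ p → dec-true (toℕ (lookup G i) ℕ.≟ toℕ j) (cong toℕ (==F⇒≡ p)))))

type-injective : ∀ {m n} {G G′ : Vec (Fin m) n} → type (m , G) ≡ type (m , G′) → ∀ j → blockSize G j ≡ blockSize G′ j
type-injective {m} {G = G} {G′} e = go id (trans (sym (ListP.map-tabulate id (blockSize G))) (trans e (ListP.map-tabulate id (blockSize G′))))
  where
  go : ∀ {k} (f : Fin k → Fin m) → tabulate (blockSize G ∘ f) ≡ tabulate (blockSize G′ ∘ f) →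
       ∀ j → blockSize G (f j) ≡ blockSize G′ (f j)
  go f h zero    = ListP.∷-injectiveˡ h
  go f h (suc j) = go (f ∘ suc) (ListP.∷-injectiveʳ h) j

type-length : ∀ {n} (G : SetComp n) → length (type G) ≡ proj₁ G
type-length (m , G) = trans (ListP.length-map _ (allFin m)) (ListP.length-tabulate id)

-- For each `j` the union of the blocks with index below `j` is an initial segment of `v`, and the
-- type fixes its size. By `cnt-initial` these unions agree for `G` and `G′`, and together they
-- determine the blocks.
monotone-unique : ∀ {n} {v : Vec (Fin n) n} → InjV v → ∀ G G′ → Mono v G → Mono v G′ → type G ≡ type G′ → G ≡ G′
monotone-unique {n} {v} v-inj (m , G) (m′ , G′) mono mono′ e
  with refl ← trans (sym (type-length (m , G))) (trans (cong length e) (type-length (m′ , G′))) =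
  cong (m ,_) (lookup-ext λ i → FinP.toℕ-injective (ℕP.≤-antisym (le G′ G (below-≡ i)) (le G G′ (λ j → sym ∘ below-≡ i j))))
  where
  thr : ∀ j → j ≤ m → cnt (λ i → toℕ (lookup G i) <ᵇ j) ≡ cnt (λ i → toℕ (lookup G′ i) <ᵇ j)
  thr zero    _ = refl
  thr (suc j) h = subst (λ j → cnt (λ i → toℕ (lookup G i) <ᵇ suc j) ≡ cnt (λ i → toℕ (lookup G′ i) <ᵇ suc j))
    (FinP.toℕ-fromℕ< h) (begin
      cnt (λ i → toℕ (lookup G i) <ᵇ suc (toℕ f))  ≡⟨ cnt-<-step G f ⟩
      cnt (λ i → toℕ (lookup G i) <ᵇ toℕ f) ℕ.+ cnt (λ i → lookup G i ==F f)
        ≡⟨ cong₂ ℕ._+_ (subst (λ j → cnt (λ i → toℕ (lookup G i) <ᵇ j) ≡ cnt (λ i → toℕ (lookup G′ i) <ᵇ j)) (sym (FinP.toℕ-fromℕ< h)) (thr j (ℕP.<⇒≤ h)))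
             (trans (sym (blockSize≡cnt G f)) (trans (type-injective {G = G} {G′} e f) (blockSize≡cnt G′ f))) ⟩
      cnt (λ i → toℕ (lookup G′ i) <ᵇ toℕ f) ℕ.+ cnt (λ i → lookup G′ i ==F f) ≡⟨ cnt-<-step G′ f ⟨
      cnt (λ i → toℕ (lookup G′ i) <ᵇ suc (toℕ f)) ∎)
    where
    open ≡-Reasoning
    f = fromℕ< h
  threshold : ∀ (H : Vec (Fin m) n) → Mono v (m , H) → ∀ j i →
              (toℕ (lookup H i) <ᵇ j) ≡ (toℕ (lookup v i) <ᵇ cnt (λ i → toℕ (lookup H i) <ᵇ j))
  threshold H mo j = cnt-initial v-inj (λ i → toℕ (lookup H i) <ᵇ j)
    (λ {i} {k} p lt → <⇒<ᵇ (ℕP.≤-<-trans (mo k i lt) (<ᵇ⇒< {toℕ (lookup H i)} {j} p)))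
  below-≡ : ∀ i j → j ≤ m → (toℕ (lookup G i) <ᵇ j) ≡ (toℕ (lookup G′ i) <ᵇ j)
  below-≡ i j h = trans (threshold G mono j i)
    (trans (cong (toℕ (lookup v i) <ᵇ_) (thr j h)) (sym (threshold G′ mono′ j i)))
  le : ∀ (H K : Vec (Fin m) n) {i} → (∀ j → j ≤ m → (toℕ (lookup K i) <ᵇ j) ≡ (toℕ (lookup H i) <ᵇ j)) →
       toℕ (lookup K i) ≤ toℕ (lookup H i)
  le H K {i} h = ℕP.≤-pred (<ᵇ⇒< {toℕ (lookup K i)} (trans (h _ (FinP.toℕ<n (lookup H i))) (<⇒<ᵇ (ℕP.n<1+n (toℕ (lookup H i))))))

seg : (α : List ℕ) → Fin (sum α) → Fin (length α)
seg (a ∷ α) p = [ (λ _ → zero) , (λ q → suc (seg α q)) ]′ (splitAt a p)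

cnt-seg : ∀ α (j : Fin (length α)) → cnt (λ p → seg α p ==F j) ≡ List.lookup α j
cnt-seg (a ∷ α) j = trans (cnt-++ a (λ p → seg (a ∷ α) p ==F j)) (trans
    (cong₂ ℕ._+_ (cnt-cong (λ i → cong (λ s → [ (λ _ → zero) , (λ q → suc (seg α q)) ]′ s ==F j) (FinP.splitAt-↑ˡ a i (sum α))))
               (cnt-cong (λ q → cong (λ s → [ (λ _ → zero) , (λ q → suc (seg α q)) ]′ s ==F j) (FinP.splitAt-↑ʳ a (sum α) q))))
    (parts j))
  where
  parts : ∀ j → cnt {a} (λ _ → zero ==F j) ℕ.+ cnt (λ q → suc (seg α q) ==F j) ≡ List.lookup (a ∷ α) j
  parts zero    = trans (cong₂ ℕ._+_ (cnt-all a) (cnt-none (sum α))) (ℕP.+-identityʳ a)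
  parts (suc j) = trans (cong (ℕ._+ cnt (λ q → seg α q ==F j)) (cnt-none a)) (cnt-seg α j)

-- The map `seg` on bare numbers, freed from the bound `sum α`, so that neighbouring positions can
-- be compared with partial sums by arithmetic.
segℕ : List ℕ → ℕ → ℕ
segℕ []      p = 0
segℕ (a ∷ α) p = if p <ᵇ a then 0 else suc (segℕ α (p ∸ a))

segℕ-< : ∀ {a} α {p} → p < a → segℕ (a ∷ α) p ≡ 0
segℕ-< α h rewrite <⇒<ᵇ h = refl

segℕ-≥ : ∀ {a} α {p} → a ≤ p → segℕ (a ∷ α) p ≡ suc (segℕ α (p ∸ a))
segℕ-≥ α h rewrite ≮⇒<ᵇ (ℕP.≤⇒≯ h) = refl

toℕ-seg : ∀ α p → toℕ (seg α p) ≡ segℕ α (toℕ p)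
toℕ-seg (a ∷ α) p with splitAt a p in e
... | inj₁ i = sym (segℕ-< α (subst (_< a) (trans (sym (FinP.toℕ-↑ˡ i (sum α))) (cong toℕ (FinP.splitAt⁻¹-↑ˡ e))) (FinP.toℕ<n i)))
... | inj₂ q with refl ← FinP.splitAt⁻¹-↑ʳ {m = a} e rewrite FinP.toℕ-↑ʳ a q =
  sym (trans (segℕ-≥ α (ℕP.m≤m+n a (toℕ q))) (cong suc (trans (cong (segℕ α) (ℕP.m+n∸m≡n a (toℕ q))) (sym (toℕ-seg α q)))))

segℕ-mono : ∀ α {p q} → p ≤ q → segℕ α p ≤ segℕ α q
segℕ-mono []      h = z≤n
segℕ-mono (a ∷ α) {p} {q} h with p ℕ.<? a
... | yes p<a rewrite segℕ-< α p<a = z≤n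
... | no  p≮a = subst₂ _≤_ (sym (segℕ-≥ α (ℕP.≮⇒≥ p≮a))) (sym (segℕ-≥ α (ℕP.≤-trans (ℕP.≮⇒≥ p≮a) h)))
  (s≤s (segℕ-mono α (ℕP.∸-monoˡ-≤ a h)))

∈ᵇ-partialSums-> : ∀ s α x → All (0 <_) α → (x ∈ᵇ partialSums s α) ≡ true → s < x
∈ᵇ-partialSums-> s (a ∷ b ∷ α) x (pa ∷ pα) h with x ℕ.≡ᵇ s ℕ.+ a in e
... | true  = subst (s <_) (sym (ℕP.≡ᵇ⇒≡ x (s ℕ.+ a) (≡⇒T e))) (ℕP.m<m+n s pa)
... | false = ℕP.≤-<-trans (ℕP.m≤m+n s a) (∈ᵇ-partialSums-> (s ℕ.+ a) (b ∷ α) x pα h)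

-- Positions are counted from 0 but descents from 1, so `suc p` names the gap between positions `p`
-- and `suc p`; a cut in this gap is a change of segment. The offset `s` is what `partialSums`
-- accumulates.
∈ᵇ-partialSums : ∀ s α → All (0 <_) α → ∀ p → suc p < sum α →
  ((s ℕ.+ suc p) ∈ᵇ partialSums s α) ≡ not (does (segℕ α p ℕ.≟ segℕ α (suc p)))
∈ᵇ-partialSums s (a ∷ []) _ p h
  rewrite segℕ-< [] (ℕP.<-trans (ℕP.n<1+n p) (subst (suc p <_) (ℕP.+-identityʳ a) h))
        | segℕ-< [] (subst (suc p <_) (ℕP.+-identityʳ a) h) = refl
∈ᵇ-partialSums s (a ∷ b ∷ α) (pa ∷ pα) p h with ℕP.<-cmp (suc p) a
... | tri< lt ne _
  rewrite segℕ-< (b ∷ α) (ℕP.<-trans (ℕP.n<1+n p) lt) | segℕ-< (b ∷ α) lt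
        | dec-false (s ℕ.+ suc p ℕ.≟ s ℕ.+ a) (ne ∘ ℕP.+-cancelˡ-≡ s _ _) =
  ¬true⇒false λ q → ℕP.<-asym (ℕP.+-monoʳ-< s lt) (∈ᵇ-partialSums-> (s ℕ.+ a) (b ∷ α) _ pα q)
... | tri≈ _ refl _
  rewrite segℕ-< (b ∷ α) (ℕP.n<1+n p) | segℕ-≥ (b ∷ α) (ℕP.≤-refl {suc p})
        | dec-true (s ℕ.+ suc p ℕ.≟ s ℕ.+ suc p) refl = refl
... | tri> _ ne gt
  rewrite segℕ-≥ (b ∷ α) (ℕP.≤-pred gt) | segℕ-≥ (b ∷ α) (ℕP.<⇒≤ gt)
        | dec-false (s ℕ.+ suc p ℕ.≟ s ℕ.+ a) (ne ∘ ℕP.+-cancelˡ-≡ s _ _)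
        | ℕP.+-∸-assoc 1 (ℕP.≤-pred gt) = begin
  (s ℕ.+ suc p) ∈ᵇ L                ≡⟨ cong (_∈ᵇ L) shift ⟩
  (s ℕ.+ a ℕ.+ suc (p ∸ a)) ∈ᵇ L      ≡⟨ ∈ᵇ-partialSums (s ℕ.+ a) (b ∷ α) pα (p ∸ a) bound ⟩
  not (does (x ℕ.≟ y))            ≡⟨ cong not (bool-ext (λ e → dec-true (suc x ℕ.≟ suc y) (cong suc (does-true (x ℕ.≟ y) e)))
                                                       (λ e → dec-true (x ℕ.≟ y) (ℕP.suc-injective (does-true (suc x ℕ.≟ suc y) e)))) ⟩
  not (does (suc x ℕ.≟ suc y))    ∎
  where
  open ≡-Reasoning
  L = partialSums (s ℕ.+ a) (b ∷ α)
  x = segℕ (b ∷ α) (p ∸ a)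
  y = segℕ (b ∷ α) (suc (p ∸ a))
  a+[p∸a]≡p : a ℕ.+ suc (p ∸ a) ≡ suc p
  a+[p∸a]≡p = trans (ℕP.+-suc a (p ∸ a)) (cong suc (ℕP.m+[n∸m]≡n (ℕP.≤-pred gt)))
  shift : s ℕ.+ suc p ≡ s ℕ.+ a ℕ.+ suc (p ∸ a)
  shift = trans (cong (s ℕ.+_) (sym a+[p∸a]≡p)) (sym (ℕP.+-assoc s a _))
  bound : suc (p ∸ a) < sum (b ∷ α)
  bound = ℕP.+-cancelˡ-< a _ _ (subst (_< a ℕ.+ sum (b ∷ α)) (sym a+[p∸a]≡p) h)

∧-elim : ∀ {a b} → (a ∧ b) ≡ true → a ≡ true × b ≡ true
∧-elim {true} h = refl , h

⊆ᵇ-tail : ∀ {L} b i xs → ((if b then (i ∷_) else (λ l → l)) xs ⊆ᵇ L) ≡ true → (xs ⊆ᵇ L) ≡ true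
⊆ᵇ-tail {L} true  i xs h = proj₂ (∧-elim {i ∈ᵇ L} h)
⊆ᵇ-tail     false i xs h = h

⊆ᵇ-cons : ∀ {L} b i xs → (b ≡ true → (i ∈ᵇ L) ≡ true) → (xs ⊆ᵇ L) ≡ true →
          ((if b then (i ∷_) else (λ l → l)) xs ⊆ᵇ L) ≡ true
⊆ᵇ-cons true  i xs p h rewrite p refl = h
⊆ᵇ-cons false i xs p h = h

descents⊆⁻ : ∀ L {k n} i (z : Vec (Fin k) n) → (descentsFrom i (map toℕ (Vec.toList z)) ⊆ᵇ L) ≡ true →
  ∀ p q → toℕ q ≡ suc (toℕ p) → toℕ (lookup z q) < toℕ (lookup z p) → ((i ℕ.+ toℕ p) ∈ᵇ L) ≡ true
descents⊆⁻ L i (x ∷ y ∷ z) h zero (suc zero) e lt rewrite <⇒<ᵇ lt | ℕP.+-identityʳ i = proj₁ (∧-elim h)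
descents⊆⁻ L i (x ∷ y ∷ z) h (suc p) (suc q) e lt rewrite ℕP.+-suc i (toℕ p) =
  descents⊆⁻ L (suc i) (y ∷ z) (⊆ᵇ-tail {L} (toℕ y <ᵇ toℕ x) i _ h) p q (ℕP.suc-injective e) lt

descents⊆⁺ : ∀ L {k n} i (z : Vec (Fin k) n) →
  (∀ p q → toℕ q ≡ suc (toℕ p) → toℕ (lookup z q) < toℕ (lookup z p) → ((i ℕ.+ toℕ p) ∈ᵇ L) ≡ true) →
  (descentsFrom i (map toℕ (Vec.toList z)) ⊆ᵇ L) ≡ true
descents⊆⁺ L i []          h = refl
descents⊆⁺ L i (x ∷ [])    h = refl
descents⊆⁺ L i (x ∷ y ∷ z) h = ⊆ᵇ-cons {L} (toℕ y <ᵇ toℕ x) i _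
  (λ e → subst (λ k → (k ∈ᵇ L) ≡ true) (ℕP.+-identityʳ i) (h zero (suc zero) refl (<ᵇ⇒< e)))
  (descents⊆⁺ L (suc i) (y ∷ z) λ p q f lt →
    subst (λ k → (k ∈ᵇ L) ≡ true) (ℕP.+-suc i (toℕ p)) (h (suc p) (suc q) (cong suc f) lt))

-- A monotone `f` with equal values at the two ends is constant in between, so the single steps from
-- `p` to `q` all stay in one block.
increasing-on-blocks : ∀ {n} (f : ℕ → ℕ) (z : Fin n → ℕ) → (∀ {p q} → p ≤ q → f p ≤ f q) →
  (∀ p q → toℕ q ≡ suc (toℕ p) → f (toℕ p) ≡ f (toℕ q) → z p < z q) →
  ∀ p q → toℕ p < toℕ q → f (toℕ p) ≡ f (toℕ q) → z p < z q
increasing-on-blocks {n} f z f-mono step p q p<q e = go (toℕ q) q refl p<q e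
  where
  go : ∀ k (q : Fin n) → toℕ q ≡ k → toℕ p < k → f (toℕ p) ≡ f k → z p < z q
  go (suc k) q e (s≤s p≤k) fe with ℕP.m≤n⇒m<n∨m≡n p≤k
  ... | inj₂ refl = step p q e (trans fe (cong f (sym e)))
  ... | inj₁ p<k  = ℕP.<-trans (go k q′ toℕq′ p<k fp≡fk)
        (step q′ q (trans e (cong suc (sym toℕq′))) (trans (cong f toℕq′) (trans (sym fp≡fk) (trans fe (cong f (sym e))))))
    where
    k<n : k < n
    k<n = ℕP.≤-trans (ℕP.≤-reflexive (sym e)) (ℕP.<⇒≤ (FinP.toℕ<n q))
    q′ = fromℕ< k<n
    toℕq′ : toℕ q′ ≡ k
    toℕq′ = FinP.toℕ-fromℕ< k<n
    fp≡fk : f (toℕ p) ≡ f k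
    fp≡fk = ℕP.≤-antisym (f-mono p≤k) (ℕP.≤-trans (f-mono (ℕP.n≤1+n k)) (ℕP.≤-reflexive (sym fe)))

segments : ∀ α → Vec (Fin (sum α)) (sum α) → SetComp (sum α)
segments α v = length α , Vec.tabulate (seg α ∘ lookup v)

module _ (α : List ℕ) (α-pos : All (0 <_) α) {v : Vec (Fin (sum α)) (sum α)} (v-inj : InjV v) where

  private
    G₀ = proj₂ (segments α v)

    lookup-G₀ : ∀ i → lookup G₀ i ≡ seg α (lookup v i)
    lookup-G₀ = VecP.lookup∘tabulate _

    toℕ-G₀ : ∀ i → toℕ (lookup G₀ i) ≡ segℕ α (toℕ (lookup v i))
    toℕ-G₀ i = trans (cong toℕ (lookup-G₀ i)) (toℕ-seg α _)

    cnt-block : ∀ j → cnt (λ i → lookup G₀ i ==F j) ≡ List.lookup α j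
    cnt-block j = trans (cnt-cong (λ i → cong (_==F j) (lookup-G₀ i)))
      (trans (cnt-permute (λ p → seg α p ==F j) v-inj) (cnt-seg α j))

  segments-mono : Mono v (segments α v)
  segments-mono i k lt = subst₂ _≤_ (sym (toℕ-G₀ i)) (sym (toℕ-G₀ k)) (segℕ-mono α (ℕP.<⇒≤ lt))

  segments-type : type (segments α v) ≡ α
  segments-type = trans (ListP.map-tabulate id (blockSize G₀))
    (trans (ListP.tabulate-cong (λ j → trans (blockSize≡cnt G₀ j) (cnt-block j))) (ListP.tabulate-lookup α))

  segments-surjective : SurjV G₀
  segments-surjective = surjV λ j →
    let i , e = cnt-∃ _ (subst (0 <_) (sym (cnt-block j)) (All.lookup α-pos (∈-lookup {xs = α} j)))
    in i , ==F⇒≡ e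

  module _ {z y : Vec (Fin (sum α)) (sum α)} (z-inj : InjV z) (zv : z ∘ₚ v ≡ y) where

    private
      lookup-y : ∀ i → lookup y i ≡ lookup z (lookup v i)
      lookup-y i = trans (cong (λ w → lookup w i) (sym zv)) (lookup-∘ₚ z v i)

    -- Read along `v`, the values of `y` are those of `z`. If `z` descends only at cuts, `y`
    -- increases along every segment, so inside a block the order of `v` is that of `y`; between
    -- blocks it follows the segments by construction.
    Des⊆⇒ord : (Des z ⊆ᵇ D α) ≡ true → ord v ≡ G₀ ◁ ord y
    Des⊆⇒ord h = at-ext λ i j → trans (at-mk _ i j) (bool-ext (fwd i j ∘ <ᵇ⇒<) (λ p → <⇒<ᵇ (bwd i j p)))
      where
      step : ∀ p q → toℕ q ≡ suc (toℕ p) → segℕ α (toℕ p) ≡ segℕ α (toℕ q) → toℕ (lookup z p) < toℕ (lookup z q)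
      step p q e se = ℕP.≤∧≢⇒< (ℕP.≮⇒≥ ¬desc) (λ e′ → ℕP.<-irrefl (cong toℕ (inj z-inj (FinP.toℕ-injective e′)))
                                                          (subst (toℕ p <_) (sym e) (ℕP.n<1+n _)))
        where
        ¬desc : ¬ (toℕ (lookup z q) < toℕ (lookup z p))
        ¬desc lt = true≢false
          (trans (sym (∈ᵇ-partialSums 0 α α-pos (toℕ p) (subst (_< sum α) e (FinP.toℕ<n q))))
                 (descents⊆⁻ (D α) 1 z h p q e lt))
          (cong not (dec-true (_ ℕ.≟ _) (trans se (cong (segℕ α) e))))
      incr : ∀ p q → toℕ p < toℕ q → segℕ α (toℕ p) ≡ segℕ α (toℕ q) → toℕ (lookup z p) < toℕ (lookup z q)
      incr = increasing-on-blocks (segℕ α) (toℕ ∘ lookup z) (segℕ-mono α) step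
      fwd : ∀ i j → toℕ (lookup v i) < toℕ (lookup v j) → at (G₀ ◁ ord y) i j ≡ true
      fwd i j lt with lookup G₀ i Fin.≟ lookup G₀ j
      ... | yes e = trans (at-◁-same G₀ (ord y) e) (trans (at-mk _ i j)
            (<⇒<ᵇ (subst₂ (λ a b → toℕ a < toℕ b) (sym (lookup-y i)) (sym (lookup-y j))
               (incr _ _ lt (trans (sym (toℕ-G₀ i)) (trans (cong toℕ e) (toℕ-G₀ j)))))))
      ... | no ne = at-◁-< G₀ (ord y) (ℕP.≤∧≢⇒< (segments-mono i j lt) (ne ∘ FinP.toℕ-injective))
      bwd : ∀ i j → at (G₀ ◁ ord y) i j ≡ true → toℕ (lookup v i) < toℕ (lookup v j)
      bwd i j p with ℕP.<-cmp (toℕ (lookup v i)) (toℕ (lookup v j))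
      ... | tri< lt _ _ = lt
      ... | tri> _ _ gt = contradiction (trans< R p (fwd j i gt)) (λ q → true≢false q (irrefl R i))
        where R = STO-◁ G₀ (STO-ord (subst InjV zv (∘ₚ-injective z-inj v-inj)))
      ... | tri≈ _ eq _ with refl ← inj v-inj (FinP.toℕ-injective eq) = contradiction p (λ q → true≢false q (irrefl R i))
        where R = STO-◁ G₀ (STO-ord (subst InjV zv (∘ₚ-injective z-inj v-inj)))

    -- Since `proj₂ G ◁ ord y` compares by blocks first, `G` is monotone along `v`, and
    -- `monotone-unique` leaves one candidate. Hence the sum in `B-sum` has at most one nonzero
    -- term.
    ord⇒segments : ∀ G → type G ≡ α → ord v ≡ proj₂ G ◁ ord y → G ≡ segments α v
    ord⇒segments G tG e = monotone-unique v-inj G (segments α v)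
      (λ i k lt → at-◁-≤ (proj₂ G) (ord y) (trans (cong (λ r → at r i k) (sym e)) (trans (at-mk _ i k) (<⇒<ᵇ lt))))
      segments-mono (trans tG (sym segments-type))

    ord⇒Des⊆ : ord v ≡ G₀ ◁ ord y → (Des z ⊆ᵇ D α) ≡ true
    ord⇒Des⊆ e = descents⊆⁺ (D α) 1 z λ p q pq lt →
      trans (∈ᵇ-partialSums 0 α α-pos (toℕ p) (subst (_< sum α) pq (FinP.toℕ<n q)))
            (cong not (dec-false (_ ℕ.≟ _) (λ se → ℕP.<-asym lt (same p q pq (trans se (cong (segℕ α) (sym pq)))))))
      where
      same : ∀ p q → toℕ q ≡ suc (toℕ p) → segℕ α (toℕ p) ≡ segℕ α (toℕ q) → toℕ (lookup z p) < toℕ (lookup z q)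
      same p q pq se with injective⇒surjective (inj v-inj) p | injective⇒surjective (inj v-inj) q
      ... | i , refl | j , refl = subst₂ (λ a b → toℕ a < toℕ b) (lookup-y i) (lookup-y j)
          (<ᵇ⇒< (trans (sym (at-mk _ i j)) (trans (sym (at-◁-same G₀ (ord y)
             (FinP.toℕ-injective (trans (toℕ-G₀ i) (trans se (sym (toℕ-G₀ j)))))))
             (trans (cong (λ r → at r i j) (sym e)) (trans (at-mk _ i j) (<⇒<ᵇ (ℕP.≤-reflexive (sym pq))))))))

_==O_ : ∀ {n} → Ord n → Ord n → Bool
r ==O s = does (VecP.≡-dec (VecP.≡-dec Bool._≟_) r s)

==O⇒≡ : ∀ {n} {r s : Ord n} → (r ==O s) ≡ true → r ≡ s
==O⇒≡ {r = r} {s} = does-true (VecP.≡-dec (VecP.≡-dec Bool._≟_) r s)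

≡⇒==O : ∀ {n} {r s : Ord n} → r ≡ s → (r ==O s) ≡ true
≡⇒==O {r = r} {s} = dec-true (VecP.≡-dec (VecP.≡-dec Bool._≟_) r s)

==V⇒≡ : ∀ {m n} {u v : Vec (Fin m) n} → (u ==V v) ≡ true → u ≡ v
==V⇒≡ {u = u} {v} = does-true (VecP.≡-dec Fin._≟_ u v)

≡⇒==V : ∀ {m n} {u v : Vec (Fin m) n} → u ≡ v → (u ==V v) ≡ true
≡⇒==V {u = u} {v} = dec-true (VecP.≡-dec Fin._≟_ u v)

==L⇒≡ : ∀ {u v : List ℕ} → (u ==L v) ≡ true → u ≡ v
==L⇒≡ {u} {v} = does-true (ListP.≡-dec ℕ._≟_ u v)

≡⇒==L : ∀ {u v : List ℕ} → u ≡ v → (u ==L v) ≡ true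
≡⇒==L {u} {v} = dec-true (ListP.≡-dec ℕ._≟_ u v)

preimage : ∀ {n} → Vec (Fin n) n → Fin n → Fin n
preimage v p with FinP.any? (λ i → lookup v i Fin.≟ p)
... | yes (i , _) = i
... | no  _       = p

lookup-preimage : ∀ {n} {v : Vec (Fin n) n} → InjV v → ∀ p → lookup v (preimage v p) ≡ p
lookup-preimage {v = v} v-inj p with FinP.any? (λ i → lookup v i Fin.≟ p)
... | yes (_ , e) = e
... | no  ¬e      = contradiction (injective⇒surjective (inj v-inj) p) ¬e

-- w / v is w v⁻¹ when v is a permutation, and junk otherwise.
_/_ : ∀ {n} → Vec (Fin n) n → Vec (Fin n) n → Vec (Fin n) n
w / v = Vec.tabulate (λ p → lookup w (preimage v p))

/-∘ₚ : ∀ {n} {v : Vec (Fin n) n} → InjV v → ∀ w → (w / v) ∘ₚ v ≡ w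
/-∘ₚ {v = v} v-inj w = lookup-ext λ i → trans (lookup-∘ₚ (w / v) v i) (trans (VecP.lookup∘tabulate (lookup w ∘ preimage v) (lookup v i))
  (cong (lookup w) (inj v-inj (lookup-preimage v-inj (lookup v i)))))

∘ₚ-/ : ∀ {n} {v : Vec (Fin n) n} → InjV v → ∀ u → (u ∘ₚ v) / v ≡ u
∘ₚ-/ {v = v} v-inj u = lookup-ext λ p → trans (VecP.lookup∘tabulate _ p) (trans (lookup-∘ₚ u v _)
  (cong (lookup u) (lookup-preimage v-inj p)))

/-injective : ∀ {n} {v w : Vec (Fin n) n} → InjV v → InjV w → InjV (w / v)
/-injective {v = v} {w} v-inj w-inj = injV λ {p} {q} e →
  trans (sym (lookup-preimage v-inj p)) (trans (cong (lookup v) (inj w-inj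
    (trans (sym (VecP.lookup∘tabulate _ p)) (trans e (VecP.lookup∘tabulate _ q))))) (lookup-preimage v-inj q))

-- The group algebra acting on functions of total orders

module Sums {c ℓ′ : Level} (R : CommutativeRing c ℓ′) (n : ℕ) where
  open CommutativeRing R hiding (zero) renaming (refl to ≈-refl; sym to ≈-sym; trans to ≈-trans) public
  open GroupAlgebra R n public
  open RingP ring using (-0#≈0#; -‿distribˡ-*; -‿distribʳ-*; -‿+-comm) public
  open CSG +-commutativeSemigroup using (interchange) public
  open SetoidReasoning setoid public

  private variable
    a b : Level
    A : Set a
    B′ : Set b

  Σ-cong : (l : List A) {f g : A → Carrier} → (∀ {x} → x ∈ l → f x ≈ g x) → ΣR l f ≈ ΣR l g
  Σ-cong []      h = ≈-refl
  Σ-cong (x ∷ l) h = +-cong (h (here refl)) (Σ-cong l (h ∘ there))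

  Σ-zero : (l : List A) {f : A → Carrier} → (∀ {x} → x ∈ l → f x ≈ 0#) → ΣR l f ≈ 0#
  Σ-zero []      h = ≈-refl
  Σ-zero (x ∷ l) h = ≈-trans (+-cong (h (here refl)) (Σ-zero l (h ∘ there))) (+-identityˡ 0#)

  Σ-+ : (l : List A) (f g : A → Carrier) → ΣR l (λ x → f x + g x) ≈ ΣR l f + ΣR l g
  Σ-+ []      f g = ≈-sym (+-identityˡ 0#)
  Σ-+ (x ∷ l) f g = ≈-trans (+-congˡ (Σ-+ l f g)) (interchange (f x) (g x) _ _)

  Σ-*ˡ : (l : List A) (k : Carrier) (f : A → Carrier) → ΣR l (λ x → k * f x) ≈ k * ΣR l f
  Σ-*ˡ []      k f = ≈-sym (zeroʳ k)
  Σ-*ˡ (x ∷ l) k f = ≈-trans (+-congˡ (Σ-*ˡ l k f)) (≈-sym (distribˡ k _ _))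

  Σ-*ʳ : (l : List A) (k : Carrier) (f : A → Carrier) → ΣR l (λ x → f x * k) ≈ ΣR l f * k
  Σ-*ʳ []      k f = ≈-sym (zeroˡ k)
  Σ-*ʳ (x ∷ l) k f = ≈-trans (+-congˡ (Σ-*ʳ l k f)) (≈-sym (distribʳ k _ _))

  Σ-swap : (l : List A) (l′ : List B′) (f : A → B′ → Carrier) →
           ΣR l (λ x → ΣR l′ (f x)) ≈ ΣR l′ (λ y → ΣR l (λ x → f x y))
  Σ-swap []      l′ f = ≈-sym (Σ-zero l′ (λ _ → ≈-refl))
  Σ-swap (x ∷ l) l′ f = ≈-trans (+-congˡ (Σ-swap l l′ f)) (≈-sym (Σ-+ l′ (f x) _))

  if-true : ∀ {b} {x y : Carrier} → b ≡ true → (if b then x else y) ≈ x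
  if-true refl = ≈-refl

  if-false : ∀ {b} {x y : Carrier} → b ≡ false → (if b then x else y) ≈ y
  if-false refl = ≈-refl

  if-* : ∀ b {x} → (if b then 1# else 0#) * x ≈ (if b then x else 0#)
  if-* true  = *-identityˡ _
  if-* false = zeroˡ _

  Σ-pick : {l : List A} (p : A → Bool) (f : A → Carrier) (x₀ : A) → Unique l → x₀ ∈ l → p x₀ ≡ true →
           (∀ {x} → x ∈ l → p x ≡ true → x ≡ x₀) → ΣR l (λ x → if p x then f x else 0#) ≈ f x₀
  Σ-pick {l = x ∷ l} p f x₀ (x∉l ∷ u) (here refl) px₀ only = begin
    (if p x then f x else 0#) + ΣR l _ ≈⟨ +-cong (if-true px₀) (Σ-zero l λ {y} y∈l → if-false (¬true⇒false
                                            λ py → All.lookup x∉l y∈l (sym (only (there y∈l) py)))) ⟩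
    f x + 0#                           ≈⟨ +-identityʳ _ ⟩
    f x                                ∎
  Σ-pick {l = x ∷ l} p f x₀ (x∉l ∷ u) (there x₀∈l) px₀ only = begin
    (if p x then f x else 0#) + ΣR l _ ≈⟨ +-cong (if-false (¬true⇒false λ px → All.lookup x∉l x₀∈l (only (here refl) px)))
                                                 (Σ-pick p f x₀ u x₀∈l px₀ (only ∘ there)) ⟩
    0# + f x₀                          ≈⟨ +-identityˡ _ ⟩
    f x₀                               ∎

  ⊛-off : ∀ (f g : KS) {w} → ¬ InjV w → (f ⊛ g) w ≈ 0#
  ⊛-off f g {w} ¬inj = Σ-zero (perms n) λ {u} u∈ → Σ-zero (perms n) λ {v} v∈ → if-false
    (¬true⇒false λ e → ¬inj (subst InjV (==V⇒≡ e) (∘ₚ-injective (∈-perms⁻ u∈) (∈-perms⁻ v∈))))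

  -- For each `v` the only `u` with uv = w is w v⁻¹, so the double sum collapses to a single one.
  ⊛-formula : ∀ (f g : KS) {w} → InjV w → (f ⊛ g) w ≈ ΣR (perms n) (λ v → f (w / v) * g v)
  ⊛-formula f g {w} w-inj = ≈-trans (Σ-swap (perms n) (perms n) _) (Σ-cong (perms n) λ {v} v∈ →
    let v-inj = ∈-perms⁻ v∈ in
    Σ-pick (λ u → (u ∘ₚ v) ==V w) (λ u → f u * g v) (w / v) (perms-unique n)
      (∈-perms⁺ (/-injective v-inj w-inj)) (≡⇒==V (/-∘ₚ v-inj w))
      (λ {u} _ e → trans (sym (∘ₚ-/ v-inj u)) (cong (_/ v) (==V⇒≡ {u = u ∘ₚ v} {w} e))))

  ⊛-sub : ∀ (f g : KS) k {w} → InjV w → ((f ⊕ (⊖ ι k)) ⊛ g) w ≈ (f ⊛ g) w + - (ℤ→R k * g w)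
  ⊛-sub f g k {w} w-inj = begin
    ((f ⊕ (⊖ ι k)) ⊛ g) w
      ≈⟨ ⊛-formula (f ⊕ (⊖ ι k)) g w-inj ⟩
    ΣR (perms n) (λ v → (f (w / v) + - (ℤ→R k * 𝟙 (w / v))) * g v)
      ≈⟨ Σ-cong (perms n) (λ _ → distribʳ _ _ _) ⟩
    ΣR (perms n) (λ v → f (w / v) * g v + - (ℤ→R k * 𝟙 (w / v)) * g v)
      ≈⟨ Σ-+ (perms n) _ _ ⟩
    ΣR (perms n) (λ v → f (w / v) * g v) + ΣR (perms n) (λ v → - (ℤ→R k * 𝟙 (w / v)) * g v)
      ≈⟨ +-cong (≈-sym (⊛-formula f g w-inj)) (Σ-cong (perms n) (λ _ → term)) ⟩
    (f ⊛ g) w + ΣR (perms n) (λ v → if idPerm n ==V (w / v) then - (ℤ→R k * g v) else 0#)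
      ≈⟨ +-congˡ (Σ-pick (λ v → idPerm n ==V (w / v)) (λ v → - (ℤ→R k * g v)) w (perms-unique n) (∈-perms⁺ w-inj)
           (≡⇒==V (trans (sym (∘ₚ-/ w-inj (idPerm n))) (cong (_/ w) (idPerm-∘ₚ w))))
           (λ {v} v∈ e → trans (trans (sym (idPerm-∘ₚ v)) (cong (_∘ₚ v) (==V⇒≡ {u = idPerm n} {w / v} e))) (/-∘ₚ (∈-perms⁻ v∈) w))) ⟩
    (f ⊛ g) w + - (ℤ→R k * g w) ∎
    where
    term : ∀ {v} → - (ℤ→R k * 𝟙 (w / v)) * g v ≈ (if idPerm n ==V (w / v) then - (ℤ→R k * g v) else 0#)
    term {v} with idPerm n ==V (w / v)
    ... | true  = ≈-trans (≈-sym (-‿distribˡ-* _ _)) (-‿cong (*-congʳ (*-identityʳ _)))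
    ... | false = ≈-trans (≈-sym (-‿distribˡ-* _ _)) (≈-trans (-‿cong (≈-trans (*-congʳ (zeroʳ _)) (zeroˡ _))) -0#≈0#)

  w₀⊛ : ∀ (g : KS) {u} → InjV u → (w₀elt ⊛ g) u ≈ g (w₀ n ∘ₚ u)
  w₀⊛ g {u} u-inj = begin
    (w₀elt ⊛ g) u                                              ≈⟨ ⊛-formula w₀elt g u-inj ⟩
    ΣR (perms n) (λ v → w₀elt (u / v) * g v)                   ≈⟨ Σ-cong (perms n) (λ {v} _ → if-* (w₀ n ==V (u / v))) ⟩
    ΣR (perms n) (λ v → if w₀ n ==V (u / v) then g v else 0#)
      ≈⟨ Σ-pick (λ v → w₀ n ==V (u / v)) g (w₀ n ∘ₚ u) (perms-unique n) (∈-perms⁺ w₀u-inj)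
           (≡⇒==V (trans (sym (∘ₚ-/ w₀u-inj (w₀ n))) (cong (_/ (w₀ n ∘ₚ u)) (w₀-∘ₚ-w₀ u))))
           (λ {v} v∈ e → trans (sym (w₀-∘ₚ-w₀ v)) (cong (w₀ n ∘ₚ_) (trans (cong (_∘ₚ v) (==V⇒≡ {u = w₀ n} {u / v} e)) (/-∘ₚ (∈-perms⁻ v∈) u)))) ⟩
    g (w₀ n ∘ₚ u)                                              ∎
    where
    w₀u-inj : InjV (w₀ n ∘ₚ u)
    w₀u-inj = ∘ₚ-injective (w₀-injective n) u-inj

  ⊛w₀ : ∀ (g : KS) {u} → InjV u → (g ⊛ w₀elt) u ≈ g (u ∘ₚ w₀ n)
  ⊛w₀ g {u} u-inj = begin
    (g ⊛ w₀elt) u                                              ≈⟨ ⊛-formula g w₀elt u-inj ⟩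
    ΣR (perms n) (λ v → g (u / v) * w₀elt v)                   ≈⟨ Σ-cong (perms n) (λ {v} _ → ≈-trans (*-comm _ _) (if-* (w₀ n ==V v))) ⟩
    ΣR (perms n) (λ v → if w₀ n ==V v then g (u / v) else 0#)
      ≈⟨ Σ-pick (λ v → w₀ n ==V v) (λ v → g (u / v)) (w₀ n) (perms-unique n) (∈-perms⁺ (w₀-injective n)) (≡⇒==V {u = w₀ n} refl)
           (λ {v} _ e → sym (==V⇒≡ e)) ⟩
    g (u / w₀ n)                                               ≈⟨ reflexive (cong g (trans (cong (_/ w₀ n) (sym uww)) (∘ₚ-/ (w₀-injective n) (u ∘ₚ w₀ n)))) ⟩
    g (u ∘ₚ w₀ n)                                              ∎
    where
    uww : (u ∘ₚ w₀ n) ∘ₚ w₀ n ≡ u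
    uww = trans (∘ₚ-assoc u (w₀ n) (w₀ n)) (trans (cong (u ∘ₚ_) (w₀-involutive n)) (∘ₚ-idPerm u))

setCompsOfType : ∀ n → List ℕ → List (SetComp n)
setCompsOfType n α = filter (λ G → T? (type G ==L α)) (setComps n)

module Action {c ℓ′ : Level} (R : CommutativeRing c ℓ′) (n : ℕ) (α : List ℕ) where
  open Sums R n public

  Gs : List (SetComp n)
  Gs = setCompsOfType n α

  Gs-unique : Unique Gs
  Gs-unique = UniqueP.filter⁺ _ (setComps-unique n)

  Fun : Set c
  Fun = Ord n → Carrier

  -- A coefficient that is 0 or 1 is spread over all `G` of type `α`, of which at most one
  -- contributes. In this form multiplication by `B α` becomes a sum of operators, one for each `G`.
  B-sum : All (0 <_) α → sum α ≡ n → ∀ {z v y} → InjV z → InjV v → z ∘ₚ v ≡ y →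
          B α z ≈ ΣR Gs (λ G → if ord v ==O (proj₂ G ◁ ord y) then 1# else 0#)
  B-sum pos refl {z} {v} {y} z-inj v-inj zv rewrite isInjective⁺ z z-inj with Des z ⊆ᵇ D α in e
  ... | true  = ≈-sym (Σ-pick (λ G → ord v ==O (proj₂ G ◁ ord y)) (λ _ → 1#) (segments α v) Gs-unique
        (∈-filter⁺ _ (∈-setComps⁺ (segments-surjective α pos v-inj)) (≡⇒T (≡⇒==L (segments-type α pos v-inj))))
        (≡⇒==O (Des⊆⇒ord α pos v-inj z-inj zv e))
        (λ {G} G∈ p → ord⇒segments α pos v-inj z-inj zv G
          (==L⇒≡ (T⇒≡ (proj₂ (∈-filter⁻ (λ G → T? (type G ==L α)) {xs = setComps n} G∈)))) (==O⇒≡ p)))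
  ... | false = ≈-sym (Σ-zero Gs λ {G} G∈ → if-false (¬true⇒false λ p →
        true≢false (ord⇒Des⊆ α pos v-inj z-inj zv (subst (λ G → ord v ≡ proj₂ G ◁ ord y)
          (ord⇒segments α pos v-inj z-inj zv G
            (==L⇒≡ (T⇒≡ (proj₂ (∈-filter⁻ (λ G → T? (type G ==L α)) {xs = setComps n} G∈)))) (==O⇒≡ p)) (==O⇒≡ p))) e))

  -- Abstracts from the way a set composition moves an order, so that both products of the theorem
  -- are instances: `act₁` for w₀B_α and `act₂` for B_αw₀.
  module Rep (act : SetComp n → Ord n → Ord n) (act-STO : ∀ G {r} → STO r → STO (act G r)) where

    T̂ : Fun → Fun
    T̂ h r = ΣR Gs (λ G → h (act G r))

    X : ℤ → Fun → Fun
    X k h r = T̂ h r + - (ℤ→R k * h r)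

    P : List ℤ → Fun → Fun
    P l h = List.foldr X h l

    module _ (z : KS)
      (z-sum : ∀ {u v w} → InjV u → InjV v → InjV w → u ∘ₚ v ≡ w →
               z u ≈ ΣR Gs (λ G → if ord v ==O act G (ord w) then 1# else 0#)) where

      ⊛-T̂ : ∀ {g : KS} {h : Fun} → (∀ {v} → InjV v → g v ≈ h (ord v)) → ∀ {w} → InjV w → (z ⊛ g) w ≈ T̂ h (ord w)
      ⊛-T̂ {g} {h} gh {w} w-inj = begin
        (z ⊛ g) w
          ≈⟨ ⊛-formula z g w-inj ⟩
        ΣR (perms n) (λ v → z (w / v) * g v)
          ≈⟨ Σ-cong (perms n) (λ {v} v∈ → let v-inj = ∈-perms⁻ v∈ in begin
               z (w / v) * g v
                 ≈⟨ *-cong (z-sum (/-injective v-inj w-inj) v-inj w-inj (/-∘ₚ v-inj w)) (gh v-inj) ⟩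
               ΣR Gs (λ G → if ord v ==O act G (ord w) then 1# else 0#) * h (ord v)
                 ≈⟨ Σ-*ʳ Gs _ _ ⟨
               ΣR Gs (λ G → (if ord v ==O act G (ord w) then 1# else 0#) * h (ord v))
                 ≈⟨ Σ-cong Gs (λ {G} _ → if-* (ord v ==O act G (ord w))) ⟩
               ΣR Gs (λ G → if ord v ==O act G (ord w) then h (ord v) else 0#) ∎) ⟩
        ΣR (perms n) (λ v → ΣR Gs (λ G → if ord v ==O act G (ord w) then h (ord v) else 0#))
          ≈⟨ Σ-swap (perms n) Gs _ ⟩
        ΣR Gs (λ G → ΣR (perms n) (λ v → if ord v ==O act G (ord w) then h (ord v) else 0#))
          ≈⟨ Σ-cong Gs (λ {G} _ → realise G) ⟩
        T̂ h (ord w) ∎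
        where
        -- The order `act G (ord w)` belongs to exactly one permutation, its `rank`.
        realise : ∀ G → ΣR (perms n) (λ v → if ord v ==O act G (ord w) then h (ord v) else 0#) ≈ h (act G (ord w))
        realise G = ≈-trans
          (Σ-pick (λ v → ord v ==O act G (ord w)) (h ∘ ord) (rank (act G (ord w))) (perms-unique n)
            (∈-perms⁺ (rank-injective S)) (≡⇒==O (ord-rank S))
            (λ {v} v∈ e → trans (sym (rank-ord (∈-perms⁻ v∈))) (cong rank (==O⇒≡ {r = ord v} {act G (ord w)} e))))
          (reflexive (cong h (ord-rank S)))
          where
          S : STO (act G (ord w))
          S = act-STO G (STO-ord w-inj)

      ∏≈P : ∀ l {w} → InjV w → ∏ l (λ k → z ⊕ (⊖ ι k)) w ≈ P l (𝟙 ∘ rank) (ord w)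
      ∏≈P []      w-inj = reflexive (cong 𝟙 (sym (rank-ord w-inj)))
      ∏≈P (k ∷ l) {w} w-inj = ≈-trans (⊛-sub z (∏ l _) k w-inj)
        (+-cong (⊛-T̂ {h = P l (𝟙 ∘ rank)} (∏≈P l) w-inj) (-‿cong (*-congˡ (∏≈P l w-inj))))

      ∏≈0 : ∀ l → (∀ {r} → STO r → P l (𝟙 ∘ rank) r ≈ 0#) → ∏ l (λ k → z ⊕ (⊖ ι k)) ≈KS 0KS
      ∏≈0 l h w with isInjective w in e
      ... | true  = ≈-trans (∏≈P l (isInjective⁻ w e)) (h (STO-ord (isInjective⁻ w e)))
      ... | false = off l
        where
        ¬inj : ¬ InjV w
        ¬inj p = true≢false (isInjective⁺ w p) e
        off : ∀ l → ∏ l (λ k → z ⊕ (⊖ ι k)) w ≈ 0#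
        off []      = if-false (¬true⇒false λ e → ¬inj (subst InjV (==V⇒≡ {u = idPerm n} e) (idPerm-injective n)))
        off (k ∷ l) = ⊛-off _ _ ¬inj

  -- Write uv = w. Then (w₀u)v = w₀w, so a factor w₀ on the left of `B α` reverses the order on
  -- which `G` acts. And (uw₀)(w₀v) = w, so a factor on the right reverses the result.
  act₁ act₂ : SetComp n → Ord n → Ord n
  act₁ G r = proj₂ G ◁ bar r
  act₂ G r = bar (proj₂ G ◁ r)

  module Rep₁ = Rep act₁ (λ G S → STO-◁ (proj₂ G) (STO-bar S))
  module Rep₂ = Rep act₂ (λ G S → STO-bar (STO-◁ (proj₂ G) S))

  module _ (pos : All (0 <_) α) (sum≡ : sum α ≡ n) where

    w₀B-sum : ∀ {u v w} → InjV u → InjV v → InjV w → u ∘ₚ v ≡ w →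
              (w₀elt ⊛ B α) u ≈ ΣR Gs (λ G → if ord v ==O act₁ G (ord w) then 1# else 0#)
    w₀B-sum {u} {v} {w} u-inj v-inj w-inj uv = begin
      (w₀elt ⊛ B α) u   ≈⟨ w₀⊛ (B α) u-inj ⟩
      B α (w₀ n ∘ₚ u)   ≈⟨ B-sum pos sum≡ (∘ₚ-injective (w₀-injective n) u-inj) v-inj
                             (trans (∘ₚ-assoc (w₀ n) u v) (cong (w₀ n ∘ₚ_) uv)) ⟩
      ΣR Gs (λ G → if ord v ==O (proj₂ G ◁ ord (w₀ n ∘ₚ w)) then 1# else 0#)
                        ≈⟨ reflexive (cong (λ r → ΣR Gs (λ G → if ord v ==O (proj₂ G ◁ r) then 1# else 0#)) (ord-w₀ w)) ⟩
      ΣR Gs (λ G → if ord v ==O act₁ G (ord w) then 1# else 0#) ∎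

    Bw₀-sum : ∀ {u v w} → InjV u → InjV v → InjV w → u ∘ₚ v ≡ w →
              (B α ⊛ w₀elt) u ≈ ΣR Gs (λ G → if ord v ==O act₂ G (ord w) then 1# else 0#)
    Bw₀-sum {u} {v} {w} u-inj v-inj w-inj uv = begin
      (B α ⊛ w₀elt) u   ≈⟨ ⊛w₀ (B α) u-inj ⟩
      B α (u ∘ₚ w₀ n)   ≈⟨ B-sum pos sum≡ (∘ₚ-injective u-inj (w₀-injective n)) (∘ₚ-injective (w₀-injective n) v-inj)
                             (trans (∘ₚ-assoc u (w₀ n) (w₀ n ∘ₚ v)) (trans (cong (u ∘ₚ_) (w₀-∘ₚ-w₀ v)) uv)) ⟩
      ΣR Gs (λ G → if ord (w₀ n ∘ₚ v) ==O (proj₂ G ◁ ord w) then 1# else 0#)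
                        ≈⟨ Σ-cong Gs (λ {G} _ → reflexive (cong (if_then 1# else 0#) (bool-ext
                             (λ e → ≡⇒==O (trans (sym (bar-bar (ord v))) (cong bar (trans (sym (ord-w₀ v)) (==O⇒≡ e)))))
                             (λ e → ≡⇒==O (trans (ord-w₀ v) (trans (cong bar (==O⇒≡ {r = ord v} {act₂ G (ord w)} e)) (bar-bar (proj₂ G ◁ ord w)))))))) ⟩
      ΣR Gs (λ G → if ord v ==O act₂ G (ord w) then 1# else 0#) ∎

  -- By definition `act₂ G (bar r)` is `bar (act₁ G r)`: reversal intertwines the two operators,
  -- which is conjugation by w₀.
  P₂≈P₁ : ∀ l (h : Fun) r → Rep₂.P l h (bar r) ≈ Rep₁.P l (h ∘ bar) r
  P₂≈P₁ []      h r = ≈-refl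
  P₂≈P₁ (k ∷ l) h r = +-cong
    (Σ-cong Gs (λ {G} _ → P₂≈P₁ l h (act₁ G r)))
    (-‿cong (*-congˡ (P₂≈P₁ l h r)))

-- Growth of n_α under refinement

length-filter-mono : ∀ {a} {A : Set a} (p q : A → Bool) → (∀ x → p x ≡ true → q x ≡ true) → ∀ xs →
  length (filter (T? ∘ p) xs) ≤ length (filter (T? ∘ q) xs)
length-filter-mono p q h []       = z≤n
length-filter-mono p q h (x ∷ xs) with p x in px | q x in qx
... | true  | true  = s≤s (length-filter-mono p q h xs)
... | true  | false = ⊥-elim (true≢false (h x px) qx)
... | false | true  = ℕP.m≤n⇒m≤1+n (length-filter-mono p q h xs)
... | false | false = length-filter-mono p q h xs

length-filter-mono-< : ∀ {a} {A : Set a} (p q : A → Bool) → (∀ x → p x ≡ true → q x ≡ true) → ∀ {xs x} → x ∈ xs →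
  p x ≡ false → q x ≡ true → length (filter (T? ∘ p) xs) < length (filter (T? ∘ q) xs)
length-filter-mono-< p q h {x ∷ xs} (here refl) px qx rewrite px | qx = s≤s (length-filter-mono p q h xs)
length-filter-mono-< p q h {x ∷ xs} (there x∈) py qy with p x in px | q x in qx
... | true  | true  = s≤s (length-filter-mono-< p q h x∈ py qy)
... | true  | false = ⊥-elim (true≢false (h x px) qx)
... | false | true  = ℕP.m≤n⇒m≤1+n (length-filter-mono-< p q h x∈ py qy)
... | false | false = length-filter-mono-< p q h x∈ py qy

∧-intro : ∀ {a b} → a ≡ true → b ≡ true → (a ∧ b) ≡ true
∧-intro refl refl = refl

record Finer {n} (F G : SetComp n) : Set where
  constructor finer
  field joined : ∀ i j → lookup (proj₂ F) i ≡ lookup (proj₂ F) j → lookup (proj₂ G) i ≡ lookup (proj₂ G) j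

open Finer public

module _ {n} (α : List ℕ) {F′ F : SetComp n} (fine : Finer F′ F) where

  private
    coarser : ∀ G → ((F ⪯ᵇ G) ∧ (type G ==L α)) ≡ true → ((F′ ⪯ᵇ G) ∧ (type G ==L α)) ≡ true
    coarser G h = let a , b = ∧-elim {F ⪯ᵇ G} h in ∧-intro (⪯ᵇ⁺ F′ G λ i j → ⪯ᵇ⁻ F G a i j ∘ joined fine i j) b

  nα-mono : nα α F ≤ nα α F′
  nα-mono = length-filter-mono _ _ coarser (setComps n)

  -- The extra composition is `G` itself, which is counted for `F′` but not for `F`.
  nα-mono-< : ∀ {G} → G ∈ setComps n → type G ≡ α → Finer F′ G → (F ⪯ᵇ G) ≡ false → nα α F < nα α F′
  nα-mono-< {G} G∈ tG fG ¬F⪯G = length-filter-mono-< _ _ coarser G∈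
    (cong (_∧ (type G ==L α)) ¬F⪯G) (∧-intro (⪯ᵇ⁺ F′ G (joined fG)) (≡⇒==L tG))

-- The blocks are the fibres of `f`. Pairs of labels yield common refinements, and a constant `f`
-- yields the coarsest set composition.
kernel-setComp : ∀ {a} {A : Set a} → (∀ (x y : A) → Dec (x ≡ y)) → ∀ {n} (f : Fin n → A) →
  ∃ λ m → Σ (Vec (Fin m) n) λ v → SurjV v ×
    (∀ i j → lookup v i ≡ lookup v j → f i ≡ f j) × (∀ i j → f i ≡ f j → lookup v i ≡ lookup v j)
kernel-setComp _≟_ {zero}  f = 0 , [] , surjV (λ ()) , (λ ()) , (λ ())
kernel-setComp _≟_ {suc n} f with kernel-setComp _≟_ (f ∘ suc) | FinP.any? (λ j → f (suc j) ≟ f zero)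
... | m , v , s , p , q | yes (k , e) = m , lookup v k ∷ v , surjV (λ j → let i , ei = surj s j in suc i , ei) , p′ , q′
  where
  p′ : ∀ i j → lookup (lookup v k ∷ v) i ≡ lookup (lookup v k ∷ v) j → f i ≡ f j
  p′ zero    zero    _ = refl
  p′ zero    (suc j) h = trans (sym e) (p k j h)
  p′ (suc i) zero    h = trans (p i k h) e
  p′ (suc i) (suc j) h = p i j h
  q′ : ∀ i j → f i ≡ f j → lookup (lookup v k ∷ v) i ≡ lookup (lookup v k ∷ v) j
  q′ zero    zero    _ = refl
  q′ zero    (suc j) h = q k j (trans e h)
  q′ (suc i) zero    h = q i k (trans h (sym e))
  q′ (suc i) (suc j) h = q i j h
... | m , v , s , p , q | no ¬e = suc m , v′ , surjV onto , p′ , q′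
  where
  v′ : Vec (Fin (suc m)) (suc n)
  v′ = zero ∷ Vec.map suc v
  map-suc : ∀ i → lookup (Vec.map Fin.suc v) i ≡ suc (lookup v i)
  map-suc i = VecP.lookup-map i suc v
  onto : ∀ j → ∃ λ i → lookup (v′) i ≡ j
  onto zero    = zero , refl
  onto (suc j) = let i , e = surj s j in suc i , trans (map-suc i) (cong suc e)
  p′ : ∀ i j → lookup (v′) i ≡ lookup (v′) j → f i ≡ f j
  p′ zero    zero    _ = refl
  p′ zero    (suc j) h with () ← trans h (map-suc j)
  p′ (suc i) zero    h with () ← trans (sym h) (map-suc i)
  p′ (suc i) (suc j) h = p i j (FinP.suc-injective (trans (sym (map-suc i)) (trans h (map-suc j))))
  q′ : ∀ i j → f i ≡ f j → lookup (v′) i ≡ lookup (v′) j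
  q′ zero    zero    _ = refl
  q′ zero    (suc j) h = contradiction (j , sym h) ¬e
  q′ (suc i) zero    h = contradiction (i , h) ¬e
  q′ (suc i) (suc j) h = trans (map-suc i) (trans (cong suc (q i j h)) (sym (map-suc j)))

-- Faces acting on orders

-- The block of i is reversed when s i = false.  The relation c between different blocks is arbitrary,
-- so that products of faces need no explicit order on their blocks.
faceAct : ∀ {m n} → Vec (Fin m) n → (Fin n → Bool) → (Fin n → Fin n → Bool) → Ord n → Ord n
faceAct v s c r = mk λ i j → if lookup v i ==F lookup v j then (if s i then at r i j else at r j i) else c i j

module _ {m n} (v : Vec (Fin m) n) (s : Fin n → Bool) (c : Fin n → Fin n → Bool) (r : Ord n) {i j : Fin n} where

  at-face-same : lookup v i ≡ lookup v j → at (faceAct v s c r) i j ≡ (if s i then at r i j else at r j i)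
  at-face-same e = trans (at-mk _ i j) (cong (if_then (if s i then at r i j else at r j i) else c i j) (≡⇒==F e))

  at-face-diff : ¬ (lookup v i ≡ lookup v j) → at (faceAct v s c r) i j ≡ c i j
  at-face-diff e = trans (at-mk _ i j) (cong (if_then (if s i then at r i j else at r j i) else c i j) (≢⇒==F e))

faceAct-cong : ∀ {m n} (v : Vec (Fin m) n) {s s′ : Fin n → Bool} (c : Fin n → Fin n → Bool) (r : Ord n) →
               (∀ i → s i ≡ s′ i) → faceAct v s c r ≡ faceAct v s′ c r
faceAct-cong v {s} {s′} c r h = at-ext λ i j → trans (at-mk _ i j) (trans
  (cong (λ b → if lookup v i ==F lookup v j then (if b then at r i j else at r j i) else c i j) (h i)) (sym (at-mk _ i j)))

if-swap : ∀ {a} {A : Set a} b {x y : A} → (if b then y else x) ≡ (if not b then x else y)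
if-swap true  = refl
if-swap false = refl

record ConstOn {m n} (v : Vec (Fin m) n) (s : Fin n → Bool) : Set where
  constructor constOn
  field constant : ∀ i j → lookup v i ≡ lookup v j → s i ≡ s j

open ConstOn public

module _ {m n} (v : Vec (Fin m) n) (s : Fin n → Bool) (c : Fin n → Fin n → Bool) where

  -- A block of `v` lies inside a block of `G`, where `proj₂ G ◁ bar r` is `r` reversed; the
  -- reversal is absorbed into the signs.
  face-coarse : (G : SetComp n) → Finer (m , v) G → ∀ r →
                faceAct v s c (proj₂ G ◁ bar r) ≡ faceAct v (not ∘ s) c r
  face-coarse (_ , G) fine r = at-ext go
    where
    go : ∀ i j → at (faceAct v s c (G ◁ bar r)) i j ≡ at (faceAct v (not ∘ s) c r) i j
    go i j with lookup v i Fin.≟ lookup v j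
    ... | no  ne = trans (at-face-diff v s c (G ◁ bar r) ne) (sym (at-face-diff v _ c r ne))
    ... | yes e  = trans (at-face-same v s c (G ◁ bar r) e) (trans
      (cong₂ (if s i then_else_) (trans (at-◁-same G (bar r) (joined fine i j e)) (at-bar r i j))
                                 (trans (at-◁-same G (bar r) (sym (joined fine i j e))) (at-bar r j i)))
      (trans (if-swap (s i)) (sym (at-face-same v _ c r e))))

  module _ (G : SetComp n) where

    private
      Q = kernel-setComp (ProductP.≡-dec Fin._≟_ Fin._≟_) (λ i → lookup v i , lookup (proj₂ G) i)

    refinement : SetComp n
    refinement = proj₁ Q , proj₁ (proj₂ Q)

    refinement-surjective : SurjV (proj₂ refinement)
    refinement-surjective = proj₁ (proj₂ (proj₂ Q))

    refinement-fineˡ : Finer refinement (m , v)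
    refinement-fineˡ = finer λ i j e → cong proj₁ (proj₁ (proj₂ (proj₂ (proj₂ Q))) i j e)

    refinement-fineʳ : Finer refinement G
    refinement-fineʳ = finer λ i j e → cong proj₂ (proj₁ (proj₂ (proj₂ (proj₂ Q))) i j e)

    -- Elements of one block of `v` that `G` separates are compared by their blocks in `G`,
    -- backwards if `s` reverses the block of `v`. None of this involves `r`, so the composite is
    -- again a face.
    refinement-between : Fin n → Fin n → Bool
    refinement-between i j = if lookup v i ==F lookup v j
      then (if s i then toℕ (lookup (proj₂ G) i) <ᵇ toℕ (lookup (proj₂ G) j) else (toℕ (lookup (proj₂ G) j) <ᵇ toℕ (lookup (proj₂ G) i)))
      else c i j

    face-refine : ∀ r → faceAct v s c (proj₂ G ◁ bar r) ≡ faceAct (proj₂ refinement) (not ∘ s) refinement-between r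
    face-refine r = at-ext go
      where
      H = proj₂ G
      w = proj₂ refinement
      go : ∀ i j → at (faceAct v s c (H ◁ bar r)) i j ≡ at (faceAct w (not ∘ s) refinement-between r) i j
      go i j with lookup v i Fin.≟ lookup v j | lookup H i Fin.≟ lookup H j
      ... | no ne | _ = trans (at-face-diff v s c (H ◁ bar r) ne) (sym (trans
            (at-face-diff w _ refinement-between r (ne ∘ joined refinement-fineˡ i j))
            (cong (if_then (if s i then toℕ (lookup H i) <ᵇ toℕ (lookup H j) else (toℕ (lookup H j) <ᵇ toℕ (lookup H i))) else c i j) (≢⇒==F ne))))
      ... | yes e | no ne = trans (at-face-same v s c (H ◁ bar r) e) (trans
            (cong₂ (if s i then_else_) (at-◁-diff H (bar r) ne) (at-◁-diff H (bar r) (ne ∘ sym)))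
            (sym (trans (at-face-diff w _ refinement-between r (ne ∘ joined refinement-fineʳ i j))
              (cong (if_then (if s i then toℕ (lookup H i) <ᵇ toℕ (lookup H j) else (toℕ (lookup H j) <ᵇ toℕ (lookup H i))) else c i j) (≡⇒==F e)))))
      ... | yes e | yes e′ = trans (at-face-same v s c (H ◁ bar r) e) (trans
            (cong₂ (if s i then_else_) (trans (at-◁-same H (bar r) e′) (at-bar r i j)) (trans (at-◁-same H (bar r) (sym e′)) (at-bar r j i)))
            (trans (if-swap (s i)) (sym (at-face-same w _ refinement-between r (proj₂ (proj₂ (proj₂ (proj₂ Q))) i j (cong₂ _,_ e e′))))))

_⊆ᴵ_ : ∀ {n} → Vec Bool n → Vec Bool n → Set
I ⊆ᴵ B = ∀ i → lookup I i ≡ true → lookup B i ≡ true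

∅ᴵ : ∀ {n} → Vec Bool n
∅ᴵ = Vec.replicate _ false

lookup-∅ᴵ : ∀ {n} (i : Fin n) → lookup ∅ᴵ i ≡ false
lookup-∅ᴵ i = VecP.lookup-replicate i false

-- The block B ⊇ I is replaced by rev(r|_I) r|_{B∖I}, as in the antipode identity.
module _ {m n} (v : Vec (Fin m) n) (s : Fin n → Bool) (c : Fin n → Fin n → Bool) where

  -- The part `I` becomes the new block `zero`. When `I` is empty or a whole block the labelling is
  -- no longer onto; `splitAct-∅` and `splitAct-full` identify these two ends with faces on `v`
  -- itself.
  splitBlock : Vec Bool n → Vec (Fin (suc m)) n
  splitBlock I = Vec.tabulate (λ i → if lookup I i then zero else suc (lookup v i))

  splitSign : Vec Bool n → Fin n → Bool
  splitSign I i = if lookup I i then not (s i) else s i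

  -- `faceAct` consults this only across different parts. Inside one block of `v` exactly one of `i`
  -- and `j` then lies in `I`, so `lookup I i` says that `I` comes first.
  splitBetween : Vec Bool n → Fin n → Fin n → Bool
  splitBetween I i j = if lookup v i ==F lookup v j then lookup I i else c i j

  splitAct : Vec Bool n → Ord n → Ord n
  splitAct I = faceAct (splitBlock I) (splitSign I) (splitBetween I)

  private
    look : ∀ I i → lookup (splitBlock I) i ≡ (if lookup I i then zero else suc (lookup v i))
    look I = VecP.lookup∘tabulate _

    dir : Fin n → Fin n → Ord n → Bool
    dir i j r = if s i then at r i j else at r j i

  module _ (t : Fin m) (I : Vec Bool n) (I⊆ : ∀ i → lookup I i ≡ true → lookup v i ≡ t) where

    splitBlock-fine : Finer (suc m , splitBlock I) (m , v)
    splitBlock-fine = finer together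
      where
      together : ∀ i j → lookup (splitBlock I) i ≡ lookup (splitBlock I) j → lookup v i ≡ lookup v j
      together i j e with lookup I i in Ii | lookup I j in Ij | trans (sym (look I i)) (trans e (look I j))
      ... | true  | true  | _  = trans (I⊆ i Ii) (sym (I⊆ j Ij))
      ... | false | false | e′ = FinP.suc-injective e′

    splitBlock-const : ConstOn v s → ConstOn (splitBlock I) (splitSign I)
    splitBlock-const sc = constOn agree
      where
      agree : ∀ i j → lookup (splitBlock I) i ≡ lookup (splitBlock I) j → splitSign I i ≡ splitSign I j
      agree i j e with lookup I i in Ii | lookup I j in Ij | trans (sym (look I i)) (trans e (look I j))
      ... | true  | true  | _ = cong not (constant sc i j (joined splitBlock-fine i j e))
      ... | false | false | _ = constant sc i j (joined splitBlock-fine i j e)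

    splitBlock-surjective : SurjV v → (∃ λ i → lookup I i ≡ true) → (∃ λ i → lookup v i ≡ t × lookup I i ≡ false) →
                            SurjV (splitBlock I)
    splitBlock-surjective sv (i₁ , h₁) (i₀ , vi₀ , h₀) = surjV onto
      where
      onto : ∀ j → ∃ λ i → lookup (splitBlock I) i ≡ j
      onto zero = i₁ , trans (look I i₁) (cong (if_then zero else suc (lookup v i₁)) h₁)
      onto (suc j) with j Fin.≟ t
      ... | yes refl = i₀ , trans (look I i₀) (trans (cong (if_then zero else suc (lookup v i₀)) h₀) (cong suc vi₀))
      ... | no  j≢t  = let i , e = surj sv j in
        i , trans (look I i) (trans (cong (if_then zero else suc (lookup v i))
              (¬true⇒false λ Ii → j≢t (trans (sym e) (I⊆ i Ii)))) (cong suc e))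

    splitAct-diff : ∀ r i j → ¬ (lookup v i ≡ lookup v j) → at (splitAct I r) i j ≡ c i j
    splitAct-diff r i j ne = trans (at-face-diff (splitBlock I) _ (splitBetween I) r (ne ∘ joined splitBlock-fine i j))
      (cong (if_then lookup I i else c i j) (≢⇒==F ne))

    splitAct-same : ConstOn v s → ∀ r i j → lookup v i ≡ lookup v j → at (splitAct I r) i j ≡
      (if lookup I i then (if lookup I j then dir j i r else true) else (if lookup I j then false else dir i j r))
    splitAct-same sc r i j e with lookup I i in Ii | lookup I j in Ij
    ... | true | true = trans (at-face-same (splitBlock I) _ (splitBetween I) r
            (trans (look I i) (trans (cong₂ (if_then zero else_) (trans Ii (sym Ij)) (cong suc e)) (sym (look I j)))))
            (trans (cong (λ b → if (if b then not (s i) else s i) then at r i j else at r j i) Ii)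
            (trans (sym (if-swap (s i))) (cong (if_then at r j i else at r i j) (constant sc i j e))))
    ... | false | false = trans (at-face-same (splitBlock I) _ (splitBetween I) r
            (trans (look I i) (trans (cong₂ (if_then zero else_) (trans Ii (sym Ij)) (cong suc e)) (sym (look I j)))))
            (cong (λ b → if (if b then not (s i) else s i) then at r i j else at r j i) Ii)
    ... | true | false = trans (at-face-diff (splitBlock I) _ (splitBetween I) r ne)
            (trans (cong (if_then lookup I i else c i j) (≡⇒==F e)) Ii)
      where
      ne : ¬ (lookup (splitBlock I) i ≡ lookup (splitBlock I) j)
      ne e with () ← trans (sym (trans (look I i) (cong (if_then zero else suc (lookup v i)) Ii)))
                     (trans e (trans (look I j) (cong (if_then zero else suc (lookup v j)) Ij)))
    ... | false | true = trans (at-face-diff (splitBlock I) _ (splitBetween I) r ne)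
            (trans (cong (if_then lookup I i else c i j) (≡⇒==F e)) Ii)
      where
      ne : ¬ (lookup (splitBlock I) i ≡ lookup (splitBlock I) j)
      ne e with () ← trans (sym (trans (look I i) (cong (if_then zero else suc (lookup v i)) Ii)))
                     (trans e (trans (look I j) (cong (if_then zero else suc (lookup v j)) Ij)))

  module _ (sc : ConstOn v s) (t : Fin m) where

    splitAct-∅ : ∀ r → splitAct ∅ᴵ r ≡ faceAct v s c r
    splitAct-∅ r = at-ext go
      where
      none : ∀ i → lookup ∅ᴵ i ≡ true → lookup v i ≡ t
      none i h = ⊥-elim (true≢false h (lookup-∅ᴵ i))
      go : ∀ i j → at (splitAct ∅ᴵ r) i j ≡ at (faceAct v s c r) i j
      go i j with lookup v i Fin.≟ lookup v j
      ... | no  ne = trans (splitAct-diff t ∅ᴵ none r i j ne) (sym (at-face-diff v s c r ne))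
      ... | yes e  = trans (splitAct-same t ∅ᴵ none sc r i j e) (trans
            (cong₂ (λ a b → if a then (if b then dir j i r else true) else (if b then false else dir i j r)) (lookup-∅ᴵ i) (lookup-∅ᴵ j))
            (sym (at-face-same v s c r e)))

    splitAct-full : ∀ B → (∀ i → lookup B i ≡ (lookup v i ==F t)) → ∀ r → splitAct B r ≡ faceAct v (splitSign B) c r
    splitAct-full B B≡ r = at-ext go
      where
      full : ∀ i → lookup B i ≡ true → lookup v i ≡ t
      full i h = ==F⇒≡ (trans (sym (B≡ i)) h)
      cases : ∀ b i j → s i ≡ s j →
        (if b then (if b then dir j i r else true) else (if b then false else dir i j r)) ≡
        (if (if b then not (s i) else s i) then at r i j else at r j i)
      cases true  i j e rewrite sym e = if-swap (s i)
      cases false i j e = refl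
      go : ∀ i j → at (splitAct B r) i j ≡ at (faceAct v (splitSign B) c r) i j
      go i j with lookup v i Fin.≟ lookup v j
      ... | no  ne = trans (splitAct-diff t B full r i j ne) (sym (at-face-diff v _ c r ne))
      ... | yes e  = trans (splitAct-same t B full sc r i j e) (trans
            (cong (λ b → if lookup B i then (if b then dir j i r else true) else (if b then false else dir i j r))
                  (trans (B≡ j) (trans (cong (_==F t) (sym e)) (sym (B≡ i)))))
            (trans (cases (lookup B i) i j (constant sc i j e)) (sym (at-face-same v _ c r e))))

    -- x is the first element of the block; it can be moved between the reversed part I and
    -- the rest without changing the order, being last in one and first in the other.
    splitAct-toggle : ∀ {r} → STO r → ∀ x → (∀ y → lookup v y ≡ lookup v x → ¬ (x ≡ y) → dir x y r ≡ true) →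
      ∀ I → lookup v x ≡ t → (∀ i → lookup I i ≡ true → lookup v i ≡ t) → splitAct I r ≡ splitAct (I Vec.[ x ]≔ true) r
    splitAct-toggle {r} S x x-min I vx I⊆ = at-ext go
      where
      I′ = I Vec.[ x ]≔ true
      I′x : lookup I′ x ≡ true
      I′x = VecP.lookup∘updateAt x I
      I′y : ∀ {y} → ¬ (x ≡ y) → lookup I′ y ≡ lookup I y
      I′y {y} ne = VecP.lookup∘updateAt′ y x (ne ∘ sym) I
      I′⊆ : ∀ i → lookup I′ i ≡ true → lookup v i ≡ t
      I′⊆ i h with x Fin.≟ i
      ... | yes refl = vx
      ... | no  ne   = I⊆ i (trans (sym (I′y ne)) h)
      x-min′ : ∀ y → lookup v y ≡ lookup v x → ¬ (x ≡ y) → dir y x r ≡ false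
      x-min′ y e ne with s y | s x | constant sc y x e | x-min y e ne
      ... | true  | true  | refl | h = ¬true⇒false λ q → true≢false (trans< S q h) (irrefl S y)
      ... | false | false | refl | h = ¬true⇒false λ q → true≢false (trans< S q h) (irrefl S x)
      form : Bool → Bool → Fin n → Fin n → Bool
      form a b i j = if a then (if b then dir j i r else true) else (if b then false else dir i j r)
      same : ∀ i j → lookup v i ≡ lookup v j → form (lookup I i) (lookup I j) i j ≡ form (lookup I′ i) (lookup I′ j) i j
      same i j e with x Fin.≟ i | x Fin.≟ j
      same i j e | no i≢ | no j≢ = cong₂ (λ a b → form a b i j) (sym (I′y i≢)) (sym (I′y j≢))
      same i i e | yes refl | yes refl = trans (diag (lookup I x)) (cong (λ b → form b b x x) (sym I′x))
        where
        diag : ∀ b → form b b x x ≡ form true true x x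
        diag true  = refl
        diag false = refl
      same i j e | yes refl | no j≢ = trans (first (lookup I x) (lookup I j)) (cong₂ (λ a b → form a b x j) (sym I′x) (sym (I′y j≢)))
        where
        first : ∀ a b → form a b x j ≡ form true b x j
        first true  b     = refl
        first false true  = sym (x-min′ j (sym e) j≢)
        first false false = x-min j (sym e) j≢
      same i j e | no i≢ | yes refl = trans (second (lookup I i) (lookup I x)) (cong₂ (λ a b → form a b i x) (sym (I′y i≢)) (sym I′x))
        where
        second : ∀ a b → form a b i x ≡ form a true i x
        second a     true  = refl
        second true  false = sym (x-min i e i≢)
        second false false = x-min′ i e i≢
      go : ∀ i j → at (splitAct I r) i j ≡ at (splitAct I′ r) i j
      go i j with lookup v i Fin.≟ lookup v j
      ... | no  ne = trans (splitAct-diff t I I⊆ r i j ne) (sym (splitAct-diff t I′ I′⊆ r i j ne))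
      ... | yes e  = trans (splitAct-same t I I⊆ sc r i j e) (trans (same i j e) (sym (splitAct-same t I′ I′⊆ sc r i j e)))

minimum : ∀ {n} (u : Fin n → Fin n → Bool) (B : Fin n → Bool) →
  (∀ {i j} → ¬ (i ≡ j) → u i j ≡ false → u j i ≡ true) →
  (∀ {i j k} → u i j ≡ true → u j k ≡ true → u i k ≡ true) →
  (∃ λ i → B i ≡ true) → ∃ λ x → B x ≡ true × (∀ y → B y ≡ true → ¬ (x ≡ y) → u x y ≡ true)
minimum {suc n} u B tot tr (i₀ , h₀) with FinP.any? (λ i → B (suc i) Bool.≟ true)
... | no ¬h = zero , B0 i₀ h₀ , min
  where
  B0 : ∀ i → B i ≡ true → B zero ≡ true
  B0 zero    h = h
  B0 (suc i) h = contradiction (i , h) ¬h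
  min : ∀ y → B y ≡ true → ¬ (zero ≡ y) → u zero y ≡ true
  min zero    _ ne = contradiction refl ne
  min (suc y) h _  = contradiction (y , h) ¬h
... | yes ex with minimum (λ i j → u (suc i) (suc j)) (B ∘ suc) (λ ne → tot (ne ∘ FinP.suc-injective)) tr ex
... | x , Bx , x-min with B zero in B0 | u (suc x) zero in ux0
... | false | _ = suc x , Bx , min
  where
  min : ∀ y → B y ≡ true → ¬ (suc x ≡ y) → u (suc x) y ≡ true
  min zero    h _  = ⊥-elim (true≢false h B0)
  min (suc y) h ne = x-min y h (ne ∘ cong suc)
... | true | true = suc x , Bx , min
  where
  min : ∀ y → B y ≡ true → ¬ (suc x ≡ y) → u (suc x) y ≡ true
  min zero    h _  = ux0
  min (suc y) h ne = x-min y h (ne ∘ cong suc)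
... | true | false = zero , B0 , min
  where
  u0x : u zero (suc x) ≡ true
  u0x = tot (λ ()) ux0
  min : ∀ y → B y ≡ true → ¬ (zero ≡ y) → u zero y ≡ true
  min zero    _ ne = contradiction refl ne
  min (suc y) h _ with x Fin.≟ y
  ... | yes refl = u0x
  ... | no  ne   = tr u0x (x-min y h ne)

-- The filtration

∣-1^k∣≡1 : ∀ k → ℤ.∣ (ℤ.- ℤ.1ℤ) ℤ.^ k ∣ ≡ 1
∣-1^k∣≡1 zero    = refl
∣-1^k∣≡1 (suc k) = trans (ℤP.abs-* (ℤ.- ℤ.1ℤ) ((ℤ.- ℤ.1ℤ) ℤ.^ k)) (trans (ℕP.+-identityʳ _) (∣-1^k∣≡1 k))

∣ñα∣ : ∀ {n} α (F : SetComp n) → ℤ.∣ ñα α F ∣ ≡ nα α F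
∣ñα∣ {n} α F = trans (ℤP.abs-* ((ℤ.- ℤ.1ℤ) ℤ.^ (n ∸ ℓ F)) (ℤ.+ nα α F))
  (trans (cong (ℕ._* nα α F) (∣-1^k∣≡1 (n ∸ ℓ F))) (ℕP.*-identityˡ _))

-- With the count unchanged, one more block changes only the parity of the exponent; `suc m ≤ n`
-- guarantees that the truncated difference really drops by one.
ñα-refine : ∀ {n} α {m} (v : Vec (Fin m) n) (v′ : Vec (Fin (suc m)) n) → suc m ≤ n →
            nα α (suc m , v′) ≡ nα α (m , v) → ñα α (suc m , v′) ≡ ℤ.- ñα α (m , v)
ñα-refine {n} α {m} v v′ m<n e = sym (begin
  ℤ.- ((ℤ.- ℤ.1ℤ) ℤ.^ (n ∸ m) ℤ.* N)                       ≡⟨ cong (λ k → ℤ.- ((ℤ.- ℤ.1ℤ) ℤ.^ k ℤ.* N)) (ℕP.+-∸-assoc 1 m<n) ⟩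
  ℤ.- (((ℤ.- ℤ.1ℤ) ℤ.* (ℤ.- ℤ.1ℤ) ℤ.^ (n ∸ suc m)) ℤ.* N)  ≡⟨ cong ℤ.-_ (ℤP.*-assoc (ℤ.- ℤ.1ℤ) ((ℤ.- ℤ.1ℤ) ℤ.^ (n ∸ suc m)) N) ⟩
  ℤ.- ((ℤ.- ℤ.1ℤ) ℤ.* p)                                    ≡⟨ cong ℤ.-_ (ℤP.-1*i≡-i p) ⟩
  ℤ.- (ℤ.- p)                                               ≡⟨ ℤP.neg-involutive p ⟩
  p                                                         ≡⟨ cong (λ k → (ℤ.- ℤ.1ℤ) ℤ.^ (n ∸ suc m) ℤ.* ℤ.+ k) e ⟨
  ñα α (suc m , v′)                                         ∎)
  where
  open ≡-Reasoning
  N = ℤ.+ nα α (m , v)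
  p = (ℤ.- ℤ.1ℤ) ℤ.^ (n ∸ suc m) ℤ.* N

module Filtration {c ℓ′ : Level} (R : CommutativeRing c ℓ′) (n : ℕ) (α : List ℕ) where
  open Action R n α public
  open Rep₁ public
  open RingP ring using (-1*x≈-x; -‿involutive)
  open CSG *-commutativeSemigroup using () renaming (x∙yz≈y∙xz to x*yz≈y*xz; interchange to *-interchange)

  psgn : ℕ → Carrier
  psgn zero    = 1#
  psgn (suc k) = - psgn k

  psgn-+ : ∀ a b → psgn (a ℕ.+ b) ≈ psgn a * psgn b
  psgn-+ zero    b = ≈-sym (*-identityˡ _)
  psgn-+ (suc a) b = ≈-trans (-‿cong (psgn-+ a b)) (-‿distribˡ-* _ _)

  neg*neg : ∀ x y → - x * - y ≈ x * y
  neg*neg x y = begin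
    - x * - y      ≈⟨ -‿distribˡ-* x (- y) ⟨
    - (x * - y)    ≈⟨ -‿cong (-‿distribʳ-* x y) ⟨
    - (- (x * y))  ≈⟨ -‿involutive _ ⟩
    x * y          ∎

  psgn-square : ∀ a → psgn a * psgn a ≈ 1#
  psgn-square zero    = *-identityˡ _
  psgn-square (suc a) = ≈-trans (neg*neg _ _) (psgn-square a)

  ℤ→R-neg : ∀ k → ℤ→R (ℤ.- k) ≈ - ℤ→R k
  ℤ→R-neg (ℤ.+ zero)    = ≈-sym -0#≈0#
  ℤ→R-neg (ℤ.+ (suc k)) = ≈-refl
  ℤ→R-neg ℤ.-[1+ k ]    = ≈-sym (-‿involutive _)

  ℤ→R-sign : ∀ k z → ℤ→R ((ℤ.- ℤ.1ℤ) ℤ.^ k ℤ.* z) ≈ psgn k * ℤ→R z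
  ℤ→R-sign zero    z = ≈-trans (reflexive (cong ℤ→R (ℤP.*-identityˡ z))) (≈-sym (*-identityˡ _))
  ℤ→R-sign (suc k) z = begin
    ℤ→R ((ℤ.- ℤ.1ℤ) ℤ.* (ℤ.- ℤ.1ℤ) ℤ.^ k ℤ.* z)
      ≈⟨ reflexive (cong ℤ→R (trans (ℤP.*-assoc (ℤ.- ℤ.1ℤ) ((ℤ.- ℤ.1ℤ) ℤ.^ k) z) (ℤP.-1*i≡-i _))) ⟩
    ℤ→R (ℤ.- ((ℤ.- ℤ.1ℤ) ℤ.^ k ℤ.* z))  ≈⟨ ℤ→R-neg ((ℤ.- ℤ.1ℤ) ℤ.^ k ℤ.* z) ⟩
    - ℤ→R ((ℤ.- ℤ.1ℤ) ℤ.^ k ℤ.* z)      ≈⟨ -‿cong (ℤ→R-sign k z) ⟩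
    - (psgn k * ℤ→R z)                  ≈⟨ -‿distribˡ-* _ _ ⟩
    - psgn k * ℤ→R z                    ∎

  -- Agreement is asked at strict total orders only, since the antipode cancellation relies on a
  -- block having a first element.
  _≋_ : Fun → Fun → Set ℓ′
  h ≋ h′ = ∀ {r} → STO r → h r ≈ h′ r

  L : ∀ {m} → Vec (Fin m) n → (Fin n → Bool) → (Fin n → Fin n → Bool) → Fun → Fun
  L v s c g r = g (faceAct v s c r)

  -- The span is generated inductively. Because `g` is arbitrary it absorbs scalars (`scaleV`), so
  -- sums are the only linear operation among the constructors. Surjectivity makes each generator
  -- come from a set composition, hence from a value of `ñα`.
  data V (N : ℕ) : Fun → Set (c ⊔ ℓ′) where
    gen   : ∀ {m} {v : Vec (Fin m) n} → SurjV v → ∀ {s} → ConstOn v s → ∀ c g → N ≤ nα α (m , v) → V N (L v s c g)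
    zeroV : V N (λ _ → 0#)
    addV  : ∀ {h h′} → V N h → V N h′ → V N (λ r → h r + h′ r)
    respV : ∀ {h h′} → h ≋ h′ → V N h → V N h′

  scaleV : ∀ {N h} a → V N h → V N (λ r → a * h r)
  scaleV a (gen sv sc c g le) = gen sv sc c (λ r → a * g r) le
  scaleV a zeroV              = respV (λ _ → ≈-sym (zeroʳ a)) zeroV
  scaleV a (addV p q)         = respV (λ _ → ≈-sym (distribˡ a _ _)) (addV (scaleV a p) (scaleV a q))
  scaleV a (respV e p)        = respV (λ S → *-congˡ (e S)) (scaleV a p)

  negV : ∀ {N h} → V N h → V N (λ r → - h r)
  negV p = respV (λ _ → -1*x≈-x _) (scaleV (- 1#) p)

  ΣV : ∀ {a} {A : Set a} {N} (l : List A) (f : A → Fun) → (∀ {x} → x ∈ l → V N (f x)) → V N (λ r → ΣR l (λ x → f x r))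
  ΣV []      f h = zeroV
  ΣV (x ∷ l) f h = addV (h (here refl)) (ΣV l f (h ∘ there))

  record _≡[_]_ (h : Fun) (N : ℕ) (h′ : Fun) : Set (c ⊔ ℓ′) where
    constructor cong-mod
    field
      {W} : Fun
      W∈V : V N W
      eq  : ∀ {r} → STO r → h r ≈ h′ r + W r

  ≋⇒≡ : ∀ {N h h′} → h ≋ h′ → h ≡[ N ] h′
  ≋⇒≡ e = cong-mod zeroV (λ S → ≈-trans (e S) (≈-sym (+-identityʳ _)))

  V⇒≡0 : ∀ {N h} → V N h → h ≡[ N ] (λ _ → 0#)
  V⇒≡0 p = cong-mod p (λ S → ≈-sym (+-identityˡ _))

  ≡0⇒V : ∀ {N h} → h ≡[ N ] (λ _ → 0#) → V N h
  ≡0⇒V (cong-mod p e) = respV (λ S → ≈-sym (≈-trans (e S) (+-identityˡ _))) p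

  ≡-trans : ∀ {N h h′ h″} → h ≡[ N ] h′ → h′ ≡[ N ] h″ → h ≡[ N ] h″
  ≡-trans (cong-mod p e) (cong-mod p′ e′) =
    cong-mod (addV p′ p) (λ S → ≈-trans (e S) (≈-trans (+-congʳ (e′ S)) (+-assoc _ _ _)))

  ≡-+ : ∀ {N h h′ k k′} → h ≡[ N ] h′ → k ≡[ N ] k′ → (λ r → h r + k r) ≡[ N ] (λ r → h′ r + k′ r)
  ≡-+ (cong-mod p e) (cong-mod p′ e′) = cong-mod (addV p p′) (λ S → ≈-trans (+-cong (e S) (e′ S)) (interchange _ _ _ _))

  ≡-* : ∀ {N h h′} a → h ≡[ N ] h′ → (λ r → a * h r) ≡[ N ] (λ r → a * h′ r)
  ≡-* a (cong-mod p e) = cong-mod (scaleV a p) (λ S → ≈-trans (*-congˡ (e S)) (distribˡ a _ _))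

  ≡-neg : ∀ {N h h′} → h ≡[ N ] h′ → (λ r → - h r) ≡[ N ] (λ r → - h′ r)
  ≡-neg (cong-mod p e) = cong-mod (negV p) (λ S → ≈-trans (-‿cong (e S)) (≈-sym (-‿+-comm _ _)))

  -- Alt B φ = Σ_{I ⊆ B} (−1)^|I| φ(I)
  Alt : ∀ {k} → Vec Bool k → (Vec Bool k → Carrier) → Carrier
  Alt []          φ = φ []
  Alt (true  ∷ B) φ = Alt B (φ ∘ (false ∷_)) + - Alt B (φ ∘ (true ∷_))
  Alt (false ∷ B) φ = Alt B (φ ∘ (false ∷_))

  sgn : ∀ {k} → Vec Bool k → Carrier
  sgn B = psgn (cnt (lookup B))

  ⊆-false : ∀ {k b} {I B : Vec Bool k} → I ⊆ᴵ B → (false ∷ I) ⊆ᴵ (b ∷ B)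
  ⊆-false h (suc i) = h i

  ⊆-true : ∀ {k} {I B : Vec Bool k} → I ⊆ᴵ B → (true ∷ I) ⊆ᴵ (true ∷ B)
  ⊆-true h zero    = λ _ → refl
  ⊆-true h (suc i) = h i

  Alt-cong : ∀ {k} (B : Vec Bool k) {φ ψ} → (∀ I → I ⊆ᴵ B → φ I ≈ ψ I) → Alt B φ ≈ Alt B ψ
  Alt-cong []          h = h [] (λ ())
  Alt-cong (true  ∷ B) h = +-cong (Alt-cong B (λ I I⊆ → h _ (⊆-false I⊆))) (-‿cong (Alt-cong B (λ I I⊆ → h _ (⊆-true I⊆))))
  Alt-cong (false ∷ B) h = Alt-cong B (λ I I⊆ → h _ (⊆-false I⊆))

  -- Subsets without `x` pair off with those containing it, with equal `φ` and opposite signs.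
  Alt-toggle : ∀ {k} (B : Vec Bool k) {φ} x → lookup B x ≡ true → (∀ I → I ⊆ᴵ B → φ I ≈ φ (I Vec.[ x ]≔ true)) → Alt B φ ≈ 0#
  Alt-toggle (true ∷ B) zero Bx h = ≈-trans (+-congʳ (Alt-cong B (λ I I⊆ → h _ (⊆-false I⊆)))) (-‿inverseʳ _)
  Alt-toggle (true ∷ B) (suc x) Bx h = ≈-trans
    (+-cong (Alt-toggle B x Bx (λ I I⊆ → h _ (⊆-false I⊆))) (-‿cong (Alt-toggle B x Bx (λ I I⊆ → h _ (⊆-true I⊆)))))
    (-‿inverseʳ _)
  Alt-toggle (false ∷ B) (suc x) Bx h = Alt-toggle B x Bx (λ I I⊆ → h _ (⊆-false I⊆))

  module _ {N : ℕ} where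

    Alt-V : ∀ {k} (B : Vec Bool k) {Φ : Vec Bool k → Fun} → (∀ I → I ⊆ᴵ B → V N (Φ I)) → V N (λ r → Alt B (λ I → Φ I r))
    Alt-V []          h = h [] (λ ())
    Alt-V (true  ∷ B) h = addV (Alt-V B (λ I I⊆ → h _ (⊆-false I⊆))) (negV (Alt-V B (λ I I⊆ → h _ (⊆-true I⊆))))
    Alt-V (false ∷ B) h = Alt-V B (λ I I⊆ → h _ (⊆-false I⊆))

    Alt-∅ : ∀ {k} (B : Vec Bool k) {Φ : Vec Bool k → Fun} →
            (∀ I → I ⊆ᴵ B → (∃ λ i → lookup I i ≡ true) → V N (Φ I)) → (λ r → Alt B (λ I → Φ I r)) ≡[ N ] Φ ∅ᴵ
    Alt-∅ []          h = ≋⇒≡ (λ _ → ≈-refl)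
    Alt-∅ (true  ∷ B) h = ≡-trans
      (≡-+ (Alt-∅ B (λ I I⊆ (i , Ii) → h _ (⊆-false I⊆) (suc i , Ii)))
           (V⇒≡0 (negV (Alt-V B (λ I I⊆ → h _ (⊆-true I⊆) (zero , refl))))))
      (≋⇒≡ (λ _ → +-identityʳ _))
    Alt-∅ (false ∷ B) h = Alt-∅ B (λ I I⊆ (i , Ii) → h _ (⊆-false I⊆) (suc i , Ii))

    Alt-full : ∀ {k} (B : Vec Bool k) {Φ : Vec Bool k → Fun} →
               (∀ I → I ⊆ᴵ B → (∃ λ i → lookup B i ≡ true × lookup I i ≡ false) → V N (Φ I)) →
               (λ r → Alt B (λ I → Φ I r)) ≡[ N ] (λ r → sgn B * Φ B r)
    Alt-full []          h = ≋⇒≡ (λ _ → ≈-sym (*-identityˡ _))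
    Alt-full (true  ∷ B) h = ≡-trans
      (≡-+ (V⇒≡0 (Alt-V B (λ I I⊆ → h _ (⊆-false I⊆) (zero , refl , refl))))
           (≡-neg (Alt-full B (λ I I⊆ (i , Bi , Ii) → h _ (⊆-true I⊆) (suc i , Bi , Ii)))))
      (≋⇒≡ (λ _ → ≈-trans (+-identityˡ _) (-‿distribˡ-* _ _)))
    Alt-full (false ∷ B) h = Alt-full B (λ I I⊆ (i , Bi , Ii) → h _ (⊆-false I⊆) (suc i , Bi , Ii))

    -- Split at the first element of `B`. A subset avoiding it is never all of `B`, so among these
    -- only the empty one survives; a subset containing it is never empty, so among these only `B`
    -- does.
    Alt-ends : ∀ {k} (B : Vec Bool k) {Φ : Vec Bool k → Fun} → (∃ λ i → lookup B i ≡ true) →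
      (∀ I → I ⊆ᴵ B → (∃ λ i → lookup I i ≡ true) → (∃ λ i → lookup B i ≡ true × lookup I i ≡ false) → V N (Φ I)) →
      (λ r → Alt B (λ I → Φ I r)) ≡[ N ] (λ r → Φ ∅ᴵ r + sgn B * Φ B r)
    Alt-ends (true ∷ B) _ h = ≡-trans
      (≡-+ (Alt-∅ B (λ I I⊆ (i , Ii) → h _ (⊆-false I⊆) (suc i , Ii) (zero , refl , refl)))
           (≡-neg (Alt-full B (λ I I⊆ (i , Bi , Ii) → h _ (⊆-true I⊆) (zero , refl) (suc i , Bi , Ii)))))
      (≋⇒≡ (λ _ → +-congˡ (-‿distribˡ-* _ _)))
    Alt-ends (false ∷ B) (suc i₀ , h₀) h = Alt-ends B (i₀ , h₀)
      (λ I I⊆ (i , Ii) (j , Bj , Ij) → h _ (⊆-false I⊆) (suc i , Ii) (suc j , Bj , Ij))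

  -- Reversing the blocks of a face modulo the filtration

  module _ {N m} {v : Vec (Fin m) n} (sv : SurjV v)
    (splits : ∀ {v′ : Vec (Fin (suc m)) n} → SurjV v′ → Finer (suc m , v′) (m , v) → N ≤ nα α (suc m , v′))
    (c : Fin n → Fin n → Bool) (g : Fun) where

    private
      block : Fin m → Vec Bool n
      block t = Vec.tabulate (λ i → lookup v i ==F t)

      lookup-block : ∀ t i → lookup (block t) i ≡ (lookup v i ==F t)
      lookup-block t = VecP.lookup∘tabulate _

      block⇒ : ∀ t i → lookup (block t) i ≡ true → lookup v i ≡ t
      block⇒ t i h = ==F⇒≡ (trans (sym (lookup-block t i)) h)

      block⇐ : ∀ t i → lookup v i ≡ t → lookup (block t) i ≡ true
      block⇐ t i h = trans (lookup-block t i) (≡⇒==F h)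

    module _ {s : Fin n → Bool} (sc : ConstOn v s) (t : Fin m) where

      private
        Φ : Vec Bool n → Fun
        Φ I r = g (splitAct v s c I r)

        Alt≈0 : ∀ {r} → STO r → Alt (block t) (λ I → Φ I r) ≈ 0#
        Alt≈0 {r} S = Alt-toggle (block t) x (block⇐ t x vx) λ I I⊆ →
          reflexive (cong g (splitAct-toggle v s c sc t S x x-min I vx (λ i h → block⇒ t i (I⊆ i h))))
          where
          -- The order on block `t` after its possible reversal. The sign is read at one fixed
          -- element of the block, which makes `u` a single total order on all of [n].
          u : Fin n → Fin n → Bool
          u i j = if s (proj₁ (surj sv t)) then at r i j else at r j i
          u-total : ∀ {i j} → ¬ (i ≡ j) → u i j ≡ false → u j i ≡ true
          u-total ne h with s (proj₁ (surj sv t))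
          ... | true  = total S ne h
          ... | false = total S (ne ∘ sym) h
          u-trans : ∀ {i j k} → u i j ≡ true → u j k ≡ true → u i k ≡ true
          u-trans p q with s (proj₁ (surj sv t))
          ... | true  = trans< S p q
          ... | false = trans< S q p
          M = minimum u (λ i → lookup v i ==F t) u-total u-trans (proj₁ (surj sv t) , ≡⇒==F (proj₂ (surj sv t)))
          x = proj₁ M
          vx : lookup v x ≡ t
          vx = ==F⇒≡ (proj₁ (proj₂ M))
          x-min : ∀ y → lookup v y ≡ lookup v x → ¬ (x ≡ y) → (if s x then at r x y else at r y x) ≡ true
          x-min y e ne = trans (cong (if_then at r x y else at r y x) (constant sc x _ (trans vx (sym (proj₂ (surj sv t))))))
            (proj₂ (proj₂ M) y (≡⇒==F (trans e vx)) ne)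

      -- The antipode identity for block `t`, solved for its last term: a nonempty proper part `I`
      -- splits the block and gives a member of `V N`, leaving the empty part and the whole block.
      flip-block : L v (splitSign v s c (block t)) c g ≡[ N ] (λ r → - sgn (block t) * L v s c g r)
      flip-block = ≡-trans (≋⇒≡ expand) (≡-* (- sgn (block t)) (≡-trans (≡-+ (≋⇒≡ (λ _ → ≈-refl)) ends) (≋⇒≡ cancel)))
        where
        Bₜ = block t
        full : Fun
        full = L v (splitSign v s c Bₜ) c g
        ends : (λ r → Alt Bₜ (λ I → Φ I r)) ≡[ N ] (λ r → Φ ∅ᴵ r + sgn Bₜ * Φ Bₜ r)
        ends = Alt-ends Bₜ (proj₁ (surj sv t) , block⇐ t _ (proj₂ (surj sv t))) λ I I⊆ ne (i , Bi , Ii) →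
          let I⊆′ = λ i h → block⇒ t i (I⊆ i h)
              sv′ = splitBlock-surjective v s c t I I⊆′ sv ne (i , block⇒ t i Bi , Ii)
          in gen sv′ (splitBlock-const v s c t I I⊆′ sc) (splitBetween v s c I) g
                 (splits sv′ (splitBlock-fine v s c t I I⊆′))
        Φ∅ : ∀ r → Φ ∅ᴵ r ≈ L v s c g r
        Φ∅ r = reflexive (cong g (splitAct-∅ v s c sc t r))
        ΦB : ∀ r → Φ Bₜ r ≈ full r
        ΦB r = reflexive (cong g (splitAct-full v s c sc t Bₜ (lookup-block t) r))
        -- Chosen to cancel the term of the whole block once the alternating sum, which is zero, has
        -- been added.
        y : Fun
        y r = - (sgn Bₜ * full r)
        expand : full ≋ (λ r → - sgn Bₜ * (y r + Alt Bₜ (λ I → Φ I r)))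
        expand {r} S = ≈-sym (begin
          - sgn Bₜ * (y r + Alt Bₜ (λ I → Φ I r))    ≈⟨ *-congˡ (≈-trans (+-congˡ (Alt≈0 S)) (+-identityʳ _)) ⟩
          - sgn Bₜ * - (sgn Bₜ * full r)             ≈⟨ neg*neg _ _ ⟩
          sgn Bₜ * (sgn Bₜ * full r)                 ≈⟨ *-assoc _ _ _ ⟨
          (sgn Bₜ * sgn Bₜ) * full r                 ≈⟨ *-congʳ (psgn-square (cnt (lookup Bₜ))) ⟩
          1# * full r                              ≈⟨ *-identityˡ _ ⟩
          full r                                   ∎)
        cancel : (λ r → y r + (Φ ∅ᴵ r + sgn Bₜ * Φ Bₜ r)) ≋ (λ r → L v s c g r)
        cancel {r} S = begin
          y r + (Φ ∅ᴵ r + sgn Bₜ * Φ Bₜ r)          ≈⟨ +-congˡ (+-cong (Φ∅ r) (*-congˡ (ΦB r))) ⟩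
          y r + (L v s c g r + sgn Bₜ * full r)    ≈⟨ +-comm _ _ ⟩
          (L v s c g r + sgn Bₜ * full r) + y r    ≈⟨ +-assoc _ _ _ ⟩
          L v s c g r + (sgn Bₜ * full r + y r)    ≈⟨ +-congˡ (-‿inverseʳ _) ⟩
          L v s c g r + 0#                        ≈⟨ +-identityʳ _ ⟩
          L v s c g r                             ∎

    -- Blocks are reversed one at a time, each contributing -(-1)^|B|; over `m` blocks of total size
    -- `n` this multiplies to (-1)^(m+n). The hypothesis `splits` concerns `v` and not the signs, so
    -- it remains at hand after every reversal.
    flip-all : ∀ {s} → ConstOn v s → L v (not ∘ s) c g ≡[ N ] (λ r → psgn (m ℕ.+ n) * L v s c g r)
    flip-all {s} sc = ≡-trans (≋⇒≡ λ {r} _ → reflexive (cong g (faceAct-cong v c r λ i → sym (sign-m i))))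
      (≡-trans (chain m ℕP.≤-refl) (≋⇒≡ λ _ → *-congʳ (reflexive (cong (λ k → psgn (m ℕ.+ k)) all-below))))
      where
      sign : ℕ → Fin n → Bool
      sign t i = if toℕ (lookup v i) <ᵇ t then not (s i) else s i
      sign-const : ∀ t → ConstOn v (sign t)
      sign-const t = constOn λ i j e → cong₂ (λ x b → if toℕ x <ᵇ t then not b else b) e (constant sc i j e)
      sign-m : ∀ i → sign m i ≡ not (s i)
      sign-m i = cong (if_then not (s i) else s i) (<⇒<ᵇ (FinP.toℕ<n (lookup v i)))
      below : ℕ → ℕ
      below t = cnt (λ i → toℕ (lookup v i) <ᵇ t)
      all-below : below m ≡ n
      all-below = trans (cnt-cong {Q = λ _ → true} (λ i → <⇒<ᵇ (FinP.toℕ<n (lookup v i)))) (cnt-all n)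
      chain : ∀ t → t ≤ m → L v (sign t) c g ≡[ N ] (λ r → psgn (t ℕ.+ below t) * L v s c g r)
      chain zero    _   = ≋⇒≡ λ {r} _ → ≈-sym (≈-trans (*-congʳ (reflexive (cong psgn (cnt-none n)))) (*-identityˡ _))
      chain (suc t) t<m = ≡-trans (≋⇒≡ λ {r} _ → reflexive (cong g (faceAct-cong v c r next)))
        (≡-trans (flip-block (sign-const t) f) (≡-trans (≡-* (- sgn (block f)) (chain t (ℕP.<⇒≤ t<m))) (≋⇒≡ λ {r} _ → begin
          - sgn (block f) * (psgn (t ℕ.+ below t) * L v s c g r)  ≈⟨ *-assoc _ _ _ ⟨
          - sgn (block f) * psgn (t ℕ.+ below t) * L v s c g r    ≈⟨ *-congʳ (-‿distribˡ-* _ _) ⟨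
          - (sgn (block f) * psgn (t ℕ.+ below t)) * L v s c g r  ≈⟨ *-congʳ (-‿cong (psgn-+ (cnt (lookup (block f))) _)) ⟨
          psgn (suc (cnt (lookup (block f)) ℕ.+ (t ℕ.+ below t))) * L v s c g r
                                                                  ≈⟨ *-congʳ (reflexive (cong psgn (cong suc count))) ⟩
          psgn (suc t ℕ.+ below (suc t)) * L v s c g r            ∎)))
        where
        f : Fin m
        f = fromℕ< t<m
        toℕ-f : toℕ f ≡ t
        toℕ-f = FinP.toℕ-fromℕ< t<m
        count : cnt (lookup (block f)) ℕ.+ (t ℕ.+ below t) ≡ t ℕ.+ below (suc t)
        count = trans (ℕP.+-comm _ (t ℕ.+ below t)) (trans (ℕP.+-assoc t (below t) _) (cong (t ℕ.+_) (sym
          (trans (cong (below ∘ suc) (sym toℕ-f)) (trans (cnt-<-step v f)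
            (cong₂ ℕ._+_ (cong below toℕ-f) (cnt-cong (λ i → sym (lookup-block f i)))))))))
        next : ∀ i → sign (suc t) i ≡ splitSign v (sign t) c (block f) i
        next i with ℕP.<-cmp (toℕ (lookup v i)) t
        ... | tri< lt ne _ rewrite lookup-block f i | <⇒<ᵇ (ℕP.m<n⇒m<1+n lt) | <⇒<ᵇ lt
              | ≢⇒==F {i = lookup v i} {f} (λ e → ne (trans (cong toℕ e) toℕ-f)) = refl
        ... | tri≈ nlt e _ rewrite lookup-block f i | <⇒<ᵇ (s≤s (ℕP.≤-reflexive e)) | ≮⇒<ᵇ nlt
              | ≡⇒==F {i = lookup v i} {f} (FinP.toℕ-injective (trans e (sym toℕ-f))) = refl
        ... | tri> nlt ne gt rewrite lookup-block f i | ≮⇒<ᵇ (ℕP.<⇒≱ (s≤s gt)) | ≮⇒<ᵇ nlt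
              | ≢⇒==F {i = lookup v i} {f} (λ e → ne (trans (cong toℕ e) toℕ-f)) = refl

  -- The operator T on the filtration

  T̂-cong : ∀ {h h′} → h ≋ h′ → T̂ h ≋ T̂ h′
  T̂-cong e S = Σ-cong Gs (λ {G} _ → e (STO-◁ (proj₂ G) (STO-bar S)))

  T̂-+ : ∀ h h′ r → T̂ (λ r → h r + h′ r) r ≈ T̂ h r + T̂ h′ r
  T̂-+ h h′ r = Σ-+ Gs _ _

  T̂-* : ∀ a h r → T̂ (λ r → a * h r) r ≈ a * T̂ h r
  T̂-* a h r = Σ-*ˡ Gs a _

  T̂-neg : ∀ h r → T̂ (λ r → - h r) r ≈ - T̂ h r
  T̂-neg h r = begin
    T̂ (λ r → - h r) r        ≈⟨ Σ-cong Gs (λ _ → ≈-sym (-1*x≈-x _)) ⟩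
    T̂ (λ r → - 1# * h r) r   ≈⟨ T̂-* (- 1#) h r ⟩
    - 1# * T̂ h r             ≈⟨ -1*x≈-x _ ⟩
    - T̂ h r                  ∎

  T̂-zero : ∀ r → T̂ (λ _ → 0#) r ≈ 0#
  T̂-zero r = Σ-zero Gs (λ _ → ≈-refl)

  gen-act : ∀ {N m} {v : Vec (Fin m) n} {s} → ConstOn v s → ∀ c g G → N ≤ nα α (refinement v s c G) →
            V N (λ r → L v s c g (act₁ G r))
  gen-act {v = v} {s} sc c g G le = respV (λ {r} _ → reflexive (cong g (sym (face-refine v s c G r))))
    (gen (refinement-surjective v s c G) (constOn λ i j e → cong not (constant sc i j (joined (refinement-fineˡ v s c G) i j e)))
         (refinement-between v s c G) g le)

  -- Acting by `G` turns a face into one on the common refinement with `G`, and refining never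
  -- lowers n_α.
  T̂-V : ∀ {N h} → V N h → V N (T̂ h)
  T̂-V (gen {v = v} sv {s} sc c g le) = ΣV Gs (λ G r → L v s c g (act₁ G r)) λ {G} _ →
    gen-act sc c g G (ℕP.≤-trans le (nα-mono α (refinement-fineˡ v s c G)))
  T̂-V zeroV       = respV (λ {r} _ → ≈-sym (T̂-zero r)) zeroV
  T̂-V (addV {h} {h′} p q) = respV (λ {r} _ → ≈-sym (T̂-+ h h′ r)) (addV (T̂-V p) (T̂-V q))
  T̂-V (respV e p) = respV (T̂-cong e) (T̂-V p)

  T̂-gen : ∀ {m} {v : Vec (Fin m) n} {s} → ConstOn v s → ∀ c g →
          T̂ (L v s c g) ≡[ suc (nα α (m , v)) ] (λ r → ℕ→R (nα α (m , v)) * L v (not ∘ s) c g r)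
  T̂-gen {m} {v} {s} sc c g = go (setComps n) id
    where
    F : SetComp n
    F = m , v
    h′ = L v (not ∘ s) c g
    -- Recursion on the unfiltered list lets the sum over type `α` and the count of the compositions
    -- above `F` be compared entry by entry.
    go : ∀ xs → (∀ {G} → G ∈ xs → G ∈ setComps n) →
      (λ r → ΣR (filter (λ G → T? (type G ==L α)) xs) (λ G → L v s c g (act₁ G r))) ≡[ suc (nα α F) ]
      (λ r → ℕ→R (length (filter (λ G → T? ((F ⪯ᵇ G) ∧ (type G ==L α))) xs)) * h′ r)
    go []       _  = ≋⇒≡ (λ _ → ≈-sym (zeroˡ _))
    go (G ∷ xs) ⊆S with go xs (⊆S ∘ there) | F ⪯ᵇ G in F⪯G | type G ==L α in tG
    ... | rest | true  | false = rest
    ... | rest | false | false = rest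
    ... | rest | true  | true  = ≡-trans (≡-+ (≋⇒≡ λ {r} _ → reflexive (cong g (face-coarse v s c G (finer (⪯ᵇ⁻ F G F⪯G)) r))) rest)
      (≋⇒≡ λ {r} _ → ≈-trans (+-congʳ (≈-sym (*-identityˡ _))) (≈-sym (distribʳ _ 1# _)))
    ... | rest | false | true  = ≡-trans (≡-+ (V⇒≡0 (gen-act sc c g G
          (nα-mono-< α (refinement-fineˡ v s c G) (⊆S (here refl)) (==L⇒≡ tG) (refinement-fineʳ v s c G) F⪯G))) rest)
      (≋⇒≡ λ _ → +-identityˡ _)

  X-cong : ∀ k {h h′} → h ≋ h′ → X k h ≋ X k h′
  X-cong k e S = +-cong (T̂-cong e S) (-‿cong (*-congˡ (e S)))

  P-cong : ∀ l {h h′} → h ≋ h′ → P l h ≋ P l h′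
  P-cong []      e = e
  P-cong (k ∷ l) e = X-cong k (P-cong l e)

  X-+ : ∀ k h h′ r → X k (λ r → h r + h′ r) r ≈ X k h r + X k h′ r
  X-+ k h h′ r = begin
    T̂ (λ r → h r + h′ r) r + - (ℤ→R k * (h r + h′ r))
      ≈⟨ +-cong (T̂-+ h h′ r) (≈-trans (-‿cong (distribˡ _ _ _)) (≈-sym (-‿+-comm _ _))) ⟩
    (T̂ h r + T̂ h′ r) + (- (ℤ→R k * h r) + - (ℤ→R k * h′ r))
      ≈⟨ interchange _ _ _ _ ⟩
    X k h r + X k h′ r ∎

  P-+ : ∀ l h h′ → P l (λ r → h r + h′ r) ≋ (λ r → P l h r + P l h′ r)
  P-+ []      h h′ S = ≈-refl
  P-+ (k ∷ l) h h′ {r} S = ≈-trans (X-cong k (P-+ l h h′) S) (X-+ k (P l h) (P l h′) r)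

  P-zero : ∀ l → P l (λ _ → 0#) ≋ (λ _ → 0#)
  P-zero []      S = ≈-refl
  P-zero (k ∷ l) {r} S = ≈-trans (X-cong k (P-zero l) S)
    (≈-trans (+-cong (T̂-zero r) (≈-trans (-‿cong (zeroʳ _)) -0#≈0#)) (+-identityˡ _))

  T̂-X : ∀ k h r → T̂ (X k h) r ≈ T̂ (T̂ h) r + - (ℤ→R k * T̂ h r)
  T̂-X k h r = ≈-trans (T̂-+ (T̂ h) (λ r → - (ℤ→R k * h r)) r) (+-congˡ (≈-trans (T̂-neg (λ r → ℤ→R k * h r) r) (-‿cong (T̂-* _ h r))))

  -- The expansion is symmetric in `k` and `k′` up to commutativity of the ring. It yields `X-comm`,
  -- and for opposite values the difference of squares in `X-gen-pair`.
  XX : ∀ k k′ h r → X k (X k′ h) r ≈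
       (T̂ (T̂ h) r + ℤ→R k * (ℤ→R k′ * h r)) + (- (ℤ→R k * T̂ h r) + - (ℤ→R k′ * T̂ h r))
  XX k k′ h r = begin
    T̂ (X k′ h) r + - (κ * (T̂ h r + - (κ′ * h r)))
      ≈⟨ +-cong (T̂-X k′ h r) (-‿cong (≈-trans (distribˡ _ _ _) (+-congˡ (≈-sym (-‿distribʳ-* _ _))))) ⟩
    (T̂ (T̂ h) r + - (κ′ * T̂ h r)) + - (κ * T̂ h r + - (κ * (κ′ * h r)))
      ≈⟨ +-congˡ (≈-trans (≈-sym (-‿+-comm _ _)) (+-congˡ (-‿involutive _))) ⟩
    (T̂ (T̂ h) r + - (κ′ * T̂ h r)) + (- (κ * T̂ h r) + κ * (κ′ * h r))
      ≈⟨ +-congˡ (+-comm _ _) ⟩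
    (T̂ (T̂ h) r + - (κ′ * T̂ h r)) + (κ * (κ′ * h r) + - (κ * T̂ h r))
      ≈⟨ interchange _ _ _ _ ⟩
    (T̂ (T̂ h) r + κ * (κ′ * h r)) + (- (κ′ * T̂ h r) + - (κ * T̂ h r))
      ≈⟨ +-congˡ (+-comm _ _) ⟩
    (T̂ (T̂ h) r + κ * (κ′ * h r)) + (- (κ * T̂ h r) + - (κ′ * T̂ h r)) ∎
    where
    κ κ′ : Carrier
    κ  = ℤ→R k
    κ′ = ℤ→R k′

  X-comm : ∀ k k′ h → X k (X k′ h) ≋ X k′ (X k h)
  X-comm k k′ h {r} S = ≈-trans (XX k k′ h r)
    (≈-trans (+-cong (+-congˡ (x*yz≈y*xz _ _ _)) (+-comm _ _)) (≈-sym (XX k′ k h r)))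

  P-X : ∀ l k h → X k (P l h) ≋ P l (X k h)
  P-X []       k h S = ≈-refl
  P-X (k′ ∷ l) k h S = ≈-trans (X-comm k k′ (P l h) S) (X-cong k′ (P-X l k h) S)

  -- As the factors commute, the one for `k` can be moved next to `h`. About the remaining list it
  -- is enough to know that every value other than `k` is still present.
  extract : ∀ {k l} → k ∈ l → ∃ λ l′ → (∀ h → P l h ≋ P l′ (X k h)) × (∀ {k′} → k′ ∈ l → ¬ (k′ ≡ k) → k′ ∈ l′)
  extract {k} {_ ∷ l} (here refl) = l , P-X l k , λ where
    (here refl) ne → contradiction refl ne
    (there k′∈) ne → k′∈
  extract {k} {k₀ ∷ l} (there k∈) with extract k∈
  ... | l′ , e , keep = k₀ ∷ l′ , (λ h → X-cong k₀ (e h)) , λ where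
    (here refl) ne → here refl
    (there k′∈) ne → there (keep k′∈ ne)

  -- Exhausting the product level by level

  Cover : ℕ → List ℤ → Set
  Cover N l = ∀ {m} {v : Vec (Fin m) n} → SurjV v → N ≤ nα α (m , v) → ñα α (m , v) ∈ l

  module _ {m} {v : Vec (Fin m) n} {s} (sv : SurjV v) (sc : ConstOn v s) (c : Fin n → Fin n → Bool) (g : Fun) where

    private
      N = nα α (m , v)
      k = ñα α (m , v)
      ν κ : Carrier
      ν = ℕ→R N
      κ = ℤ→R k
      h h′ : Fun
      h  = L v s c g
      h′ = L v (not ∘ s) c g
      κ≈ : κ ≈ psgn (n ∸ m) * ν
      κ≈ = ℤ→R-sign (n ∸ m) (ℤ.+ N)

    -- Here `k` and -k coincide and may account for a single factor. One is enough, because T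
    -- already multiplies by N = 0 modulo the next level.
    X-gen-zero : N ≡ 0 → V (suc N) (X k h)
    X-gen-zero N≡0 = ≡0⇒V (≡-trans (≡-+ (T̂-gen sc c g) (≋⇒≡ λ _ → ≈-refl)) (≋⇒≡ λ {r} _ → begin
      ν * h′ r + - (κ * h r)  ≈⟨ +-cong (≈-trans (*-congʳ ν≈0) (zeroˡ _))
                                        (-‿cong (≈-trans (*-congʳ (≈-trans κ≈ (≈-trans (*-congˡ ν≈0) (zeroʳ _)))) (zeroˡ _))) ⟩
      0# + - 0#               ≈⟨ -‿inverseʳ 0# ⟩
      0#                      ∎))
      where
      ν≈0 : ν ≈ 0#
      ν≈0 = reflexive (cong ℕ→R N≡0)

    -- When all splittings climb to the next level, `flip-all` makes `h` an eigenvector of T modulo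
    -- that level. The eigenvalue (-1)^(m+n) N is `k`, since m + n and n - m have the same parity.
    X-gen-flip : (∀ {v′ : Vec (Fin (suc m)) n} → SurjV v′ → Finer (suc m , v′) (m , v) → suc N ≤ nα α (suc m , v′)) →
                 V (suc N) (X k h)
    X-gen-flip splits = ≡0⇒V (≡-trans (≡-+ (≡-trans (T̂-gen sc c g) (≡-* ν (flip-all sv splits c g sc))) (≋⇒≡ λ _ → ≈-refl))
      (≋⇒≡ λ {r} _ → begin
        ν * (psgn (m ℕ.+ n) * h r) + - (κ * h r)  ≈⟨ +-congʳ (≈-trans (≈-sym (*-assoc _ _ _)) (*-congʳ (≈-trans (*-comm _ _) (*-congʳ sign≈)))) ⟩
        psgn (n ∸ m) * ν * h r + - (κ * h r)      ≈⟨ +-congʳ (*-congʳ (≈-sym κ≈)) ⟩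
        κ * h r + - (κ * h r)                     ≈⟨ -‿inverseʳ _ ⟩
        0#                                        ∎))
      where
      sign≈ : psgn (m ℕ.+ n) ≈ psgn (n ∸ m)
      sign≈ = begin
        psgn (m ℕ.+ n)                      ≈⟨ reflexive (cong (λ x → psgn (m ℕ.+ x)) (ℕP.m+[n∸m]≡n (surj⇒≤ sv))) ⟨
        psgn (m ℕ.+ (m ℕ.+ (n ∸ m)))        ≈⟨ psgn-+ m _ ⟩
        psgn m * psgn (m ℕ.+ (n ∸ m))       ≈⟨ *-congˡ (psgn-+ m _) ⟩
        psgn m * (psgn m * psgn (n ∸ m))    ≈⟨ *-assoc _ _ _ ⟨
        psgn m * psgn m * psgn (n ∸ m)      ≈⟨ *-congʳ (psgn-square m) ⟩
        1# * psgn (n ∸ m)                   ≈⟨ *-identityˡ _ ⟩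
        psgn (n ∸ m)                        ∎

    -- (T + k)(T - k) = T² - k² and k² = N². Applying T twice reverses every block twice, so T² acts
    -- on `h` as N² modulo the next level.
    X-gen-pair : V (suc N) (X (ℤ.- k) (X k h))
    X-gen-pair = ≡0⇒V (≡-trans (≋⇒≡ difference) (≡-trans (≡-+ TTh (≋⇒≡ λ _ → ≈-refl)) (≋⇒≡ λ _ → -‿inverseʳ _)))
      where
      κκ≈νν : κ * κ ≈ ν * ν
      κκ≈νν = begin
        κ * κ                                         ≈⟨ *-cong κ≈ κ≈ ⟩
        (psgn (n ∸ m) * ν) * (psgn (n ∸ m) * ν)       ≈⟨ *-interchange _ _ _ _ ⟩
        (psgn (n ∸ m) * psgn (n ∸ m)) * (ν * ν)       ≈⟨ *-congʳ (psgn-square (n ∸ m)) ⟩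
        1# * (ν * ν)                                  ≈⟨ *-identityˡ _ ⟩
        ν * ν                                         ∎
      difference : X (ℤ.- k) (X k h) ≋ (λ r → T̂ (T̂ h) r + - (ν * (ν * h r)))
      difference {r} _ = begin
        X (ℤ.- k) (X k h) r
          ≈⟨ XX (ℤ.- k) k h r ⟩
        (T̂ (T̂ h) r + ℤ→R (ℤ.- k) * (κ * h r)) + (- (ℤ→R (ℤ.- k) * T̂ h r) + - (κ * T̂ h r))
          ≈⟨ +-cong (+-congˡ (*-congʳ (ℤ→R-neg k))) (+-congʳ (-‿cong (≈-trans (*-congʳ (ℤ→R-neg k)) (≈-sym (-‿distribˡ-* _ _))))) ⟩
        (T̂ (T̂ h) r + - κ * (κ * h r)) + (- (- (κ * T̂ h r)) + - (κ * T̂ h r))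
          ≈⟨ +-congˡ (-‿inverseˡ _) ⟩
        (T̂ (T̂ h) r + - κ * (κ * h r)) + 0#
          ≈⟨ +-identityʳ _ ⟩
        T̂ (T̂ h) r + - κ * (κ * h r)
          ≈⟨ +-congˡ (≈-trans (≈-sym (-‿distribˡ-* _ _)) (-‿cong (≈-trans (≈-sym (*-assoc _ _ _)) (≈-trans (*-congʳ κκ≈νν) (*-assoc _ _ _))))) ⟩
        T̂ (T̂ h) r + - (ν * (ν * h r)) ∎
      TTh : T̂ (T̂ h) ≡[ suc N ] (λ r → ν * (ν * h r))
      TTh with T̂-gen sc c g
      ... | cong-mod {W} W∈V e = ≡-trans (≋⇒≡ (T̂-cong e)) (≡-trans (≋⇒≡ λ {r} _ → T̂-+ (λ r → ν * h′ r) W r)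
        (≡-trans (≡-+ (≡-trans (≋⇒≡ λ {r} _ → T̂-* ν h′ r) (≡-* ν (≡-trans (T̂-gen {v = v} (constOn λ i j → cong not ∘ constant sc i j) c g)
          (≋⇒≡ λ {r} _ → *-congˡ (reflexive (cong g (faceAct-cong v c r λ i → BoolP.not-involutive (s i))))))))
                      (V⇒≡0 (T̂-V W∈V)))
                 (≋⇒≡ λ _ → +-identityʳ _)))

  -- The factor taken out has absolute value `N`, whereas a face above level `N` has a value of
  -- larger absolute value.
  Cover-suc : ∀ {N l l′ k} → ℤ.∣ k ∣ ≡ N → Cover (suc N) l → (∀ {k′} → k′ ∈ l → ¬ (k′ ≡ k) → k′ ∈ l′) → Cover (suc N) l′
  Cover-suc {k = k} ∣k∣≡N cover keep {m} {v} sv le = keep (cover sv le) λ e →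
    ℕP.<-irrefl (trans (sym ∣k∣≡N) (trans (cong ℤ.∣_∣ (sym e)) (∣ñα∣ α (m , v)))) le

  nα≤ : ∀ F → nα α F ≤ length (setComps n)
  nα≤ F = ListP.length-filter (λ G → T? ((F ⪯ᵇ G) ∧ (type G ==L α))) (setComps n)

  -- The number `d` bounds the levels still ahead: n_α(F) is at most the number of set compositions,
  -- so for d = 0 there are no generators left. The recursion is on `d` and, for fixed `d`, on the
  -- derivation of `V N h`.
  P-vanish : ∀ d {N l h} → length (setComps n) < d ℕ.+ N → Cover N l → V N h → P l h ≋ (λ _ → 0#)
  P-vanish d {l = l} bound cover zeroV S = P-zero l S
  P-vanish d {l = l} bound cover (addV p q) S = ≈-trans (P-+ l _ _ S)
    (≈-trans (+-cong (P-vanish d bound cover p S) (P-vanish d bound cover q S)) (+-identityˡ _))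
  P-vanish d {l = l} bound cover (respV e p) S = ≈-trans (P-cong l (λ S → ≈-sym (e S)) S) (P-vanish d bound cover p S)
  P-vanish zero bound cover (gen {m} {v} sv sc c g le) S =
    contradiction (ℕP.≤-trans le (nα≤ (m , v))) (ℕP.<⇒≱ bound)
  P-vanish (suc d) {N} {l} bound cover (gen {m} {v} sv {s} sc c g le) {r} S with ℕP.m≤n⇒m<n∨m≡n le
  ... | inj₁ lt = P-vanish d bound′ (λ sv le → cover sv (ℕP.<⇒≤ le)) (gen sv sc c g lt) S
    where
    bound′ = subst (length (setComps n) <_) (sym (ℕP.+-suc d N)) bound
  ... | inj₂ refl = exact
    where
    k = ñα α (m , v)
    bound′ : length (setComps n) < d ℕ.+ suc N
    bound′ = subst (length (setComps n) <_) (sym (ℕP.+-suc d N)) bound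
    cover′ : Cover (suc N) l
    cover′ sv le = cover sv (ℕP.<⇒≤ le)
    single : V (suc N) (X k (L v s c g)) → P l (L v s c g) r ≈ 0#
    single p with extract (cover sv ℕP.≤-refl)
    ... | l′ , e , keep = ≈-trans (e _ S) (P-vanish d bound′ (Cover-suc (∣ñα∣ α (m , v)) cover′ keep) p S)
    pair : ¬ (N ≡ 0) → ℤ.- k ∈ l → P l (L v s c g) r ≈ 0#
    -- Since `N` is nonzero, `k` and -k are different integers, and taking out the factor for `k`
    -- leaves one for -k.
    pair N≢0 -k∈l with extract (cover sv ℕP.≤-refl)
    ... | l′ , e , keep with extract (keep -k∈l (λ e → N≢0 (trans (sym (∣ñα∣ α (m , v))) (cong ℤ.∣_∣ (self-neg k (sym e))))))
      where
      self-neg : ∀ k → k ≡ ℤ.- k → k ≡ ℤ.0ℤ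
      self-neg (ℤ.+ zero) _ = refl
    ... | l″ , e′ , keep′ = ≈-trans (e _ S) (≈-trans (e′ _ S) (P-vanish d bound′
            (Cover-suc (trans (ℤP.∣-i∣≡∣i∣ k) (∣ñα∣ α (m , v))) (Cover-suc (∣ñα∣ α (m , v)) cover′ keep) keep′)
            (X-gen-pair sv sc c g) S))
    exact : P l (L v s c g) r ≈ 0#
    exact with N ℕ.≟ 0 | Any.any? (λ G → ñα α G ℤ.≟ ℤ.- k) (setComps n)
    ... | yes N≡0 | _      = single (X-gen-zero sv sc c g N≡0)
    -- A splitting that kept n_α would have value -k by `ñα-refine`, so n_α must grow strictly.
    ... | no  N≢0 | no ¬ex = single (X-gen-flip sv sc c g λ {v′} sv′ fine →
      ℕP.≤∧≢⇒< (nα-mono α fine) λ e → ¬ex (lose (∈-setComps⁺ sv′) (ñα-refine α v v′ (surj⇒≤ sv′) (sym e))))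
    ... | no  N≢0 | yes ex with find ex
    -- The face with value -k also has n_α equal to `N`, so `cover` provides its factor.
    ...   | (m′ , v′) , G∈ , e = pair N≢0 (subst (_∈ l) e (cover (∈-setComps⁻ G∈) (ℕP.≤-reflexive
              (trans (sym (∣ñα∣ α (m , v))) (trans (sym (ℤP.∣-i∣≡∣i∣ k)) (trans (cong ℤ.∣_∣ (sym e)) (∣ñα∣ α (m′ , v′))))))))

  -- The coarsest set composition with no reversal acts as the identity, so every function is a
  -- generator at level 0.
  V-0 : ∀ h → V 0 h
  V-0 h with kernel-setComp (λ (_ _ : ⊤) → yes refl) {n} (λ _ → tt)
  ... | m , v , sv , _ , q = respV (λ {r} _ → reflexive (cong h (trivial r)))
      (gen sv {λ _ → true} (constOn λ _ _ _ → refl) (λ _ _ → true) h z≤n)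
    where
    trivial : ∀ r → faceAct v (λ _ → true) (λ _ _ → true) r ≡ r
    trivial r = at-ext λ i j → at-face-same v (λ _ → true) _ r (q i j refl)

  P-ñα : ∀ h → P (ñαValues n α) h ≋ (λ _ → 0#)
  P-ñα h = P-vanish (suc (length (setComps n))) (ℕP.m≤m+n _ 0)
    (λ sv _ → ∈-deduplicate⁺ ℤ._≟_ (∈-map⁺ (ñα α) (∈-setComps⁺ sv))) (V-0 h)

theorem7p2 : {c ℓ′ : Level} (R : CommutativeRing c ℓ′) (n : ℕ) (α : List ℕ) →
    All (0 <_) α → sum α ≡ n →
    let open GroupAlgebra R n in
    (∏ (ñαValues n α) (λ k → (w₀elt ⊛ B α) ⊕ (⊖ ι k)) ≈KS 0KS)
    × (∏ (ñαValues n α) (λ k → (B α ⊛ w₀elt) ⊕ (⊖ ι k)) ≈KS 0KS)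
theorem7p2 R n α pos sum≡ =
    Rep₁.∏≈0 _ (w₀B-sum pos sum≡) (ñαValues n α) (P-ñα _)
  -- Every order is the reversal of its own reversal, which brings it into the form that `P₂≈P₁`
  -- requires.
  , Rep₂.∏≈0 _ (Bw₀-sum pos sum≡) (ñαValues n α) (λ {r} S → ≈-trans
      (reflexive (cong (Rep₂.P (ñαValues n α) _) (sym (bar-bar r))))
      (≈-trans (P₂≈P₁ (ñαValues n α) _ (bar r)) (P-ñα _ (STO-bar S))))
  where open Filtration R n α
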